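{- Let $D$ be the ring of $\mathcal S$-integers of a global field $F$ with $\operatorname{char}(F)\ne2$. Suppose the following (profinite Bateman--Horn conjecture over $D$) holds: for every $k\ge1$ and all pairwise non-associate separable irreducible polynomials $f_1,\dots,f_k\in D[x]$, with product $f$ and associated map $\mathbf f=(f_1,\dots,f_k)$, if $f(\widehat D)\cap\widehat D^*\neq\emptyset$ then the following limits exist and the equalities hold: $$\lim_{\mathfrak n\to0}\widetilde\mu_{\mathbf f|_D^{ -1}(\mathcal P(D)^k),\mathfrak n}=\mu_{\mathbf f^{ -1}((\widehat D^*)^k)},\qquad \lim_{\mathfrak n\to0}\widetilde\mu_{\mathbf f(D)\cap\mathcal P(D)^k,\mathfrak n}=\mu_{\mathbf f(\widehat D)\cap(\widehat D^*)^k}.$$ Then the following (extended Schinzel's Hypothesis H over $D$) holds: for every $d\ge1$ and all pairwise non-associate separable irreducible polynomials $f_1,\dots,f_d\in D[x]$, with product $f$ and associated map $\mathbf f=(f_1,\dots,f_d)\colon D\to D^d$, if $f(\widehat D)\cap\widehat D^*\neq\emptyset$ then the set $\mathbf f(D)\cap\mathcal P(D)^d$ is infinite.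
   Context: $\mathcal S$ is a nonempty finite set of places of $F$ containing the archimedean ones. $\widehat D=\varprojlim D/\mathfrak n$ over non-zero ideals $\mathfrak n$, with projections $\widehat\pi_{\mathfrak n}\colon\widehat D^m\to(D/\mathfrak n)^m$, unit group $\widehat D^*$, and normalized Haar measure $\mu_{\widehat D^m}$ on $\widehat D^m$; $D\subseteq\widehat D$. $\mathcal P(D)$ is the set of prime elements of $D$ (irreducible $x\in D$ with $xD$ a prime ideal). $\mathbf f$ denotes both $a\mapsto(f_1(a),\dots,f_k(a))$ on $\widehat D$ and its restriction $\mathbf f|_D$ to $D$. For $S\subseteq\widehat D^m$ nonempty let $\widetilde\mu_{S,\mathfrak n}:=\frac{|D/\mathfrak n|^m}{|\widehat\pi_{\mathfrak n}(S)|}\mathbf 1_{\widehat\pi_{\mathfrak n}^{ -1}(\widehat\pi_{\mathfrak n}(S))}\cdot\mu_{\widehat D^m}$, and $\widetilde\mu_{\emptyset,\mathfrak n}:=0$. The procounting measure is $\mu_S:=\lim_{\mathfrak n\to0}\widetilde\mu_{S,\mathfrak n}$ (if it exists), the net being indexed by non-zero ideals ordered by divisibility and limits being in the weak-* sense (convergence on every compact open subset of $\widehat D^m$). -}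

module Defs where

open import Algebra.Bundles using (CommutativeRing; RawSemiring; Semiring)
import Algebra.Definitions.RawSemiring as RawSemiringDefinitions
import Algebra.Morphism.Structures as Morphism
import Algebra.Properties.Ring as RingProperties
open import Data.Fin.Base using (Fin; zero)
open import Data.Integer.Base using (+_)
open import Data.List.Base using (List; []; _∷_; map)
open import Data.List.Relation.Unary.Any using (Any)
open import Data.Nat.Base as ℕ using (ℕ; zero; suc; NonZero)
import Data.Nat.Properties as ℕₚ
open import Data.Product.Base using (Σ; ∃; ∃-syntax; _×_; _,_)
open import Data.Rational.Base as ℚ using (ℚ; 0ℚ; 1ℚ; ½)
import Data.Rational.Properties as ℚₚ
open import Data.Rational.Solver using (module +-*-Solver)
open import Data.Sum.Base using (_⊎_)
open import Data.Vec.Functional using (Vector)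
open import Function.Base using (_∘_)
open import Function.Bundles using (_⇔_)
open import Level using (0ℓ; _⊔_) renaming (suc to lsuc)
open import Relation.Binary.Bundles using (Setoid)
open import Relation.Binary.Core using (Rel)
open import Relation.Binary.PropositionalEquality using (_≡_; _≢_; refl; sym; cong; subst; module ≡-Reasoning)
open import Relation.Nullary using (¬_)
open import Relation.Unary using (Pred; U; _∩_)

IsCauchy : (ℕ → ℚ) → Set
IsCauchy s = ∀ ε → 0ℚ ℚ.< ε →
  ∃[ N ] ∀ m n → N ℕ.≤ m → N ℕ.≤ n → ℚ.∣ s m ℚ.- s n ∣ ℚ.< ε

record ℝ : Set where
  constructor mkℝ
  field
    seq    : ℕ → ℚ
    cauchy : IsCauchy seq

open ℝ

private
  half-pos : ∀ ε → 0ℚ ℚ.< ε → 0ℚ ℚ.< ½ ℚ.* ε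
  half-pos ε ε>0 = subst (ℚ._< ½ ℚ.* ε) (ℚₚ.*-zeroʳ ½) (ℚₚ.*-monoʳ-<-pos ½ ε>0)

  half+half : ∀ ε → ½ ℚ.* ε ℚ.+ ½ ℚ.* ε ≡ ε
  half+half ε = begin
    ½ ℚ.* ε ℚ.+ ½ ℚ.* ε  ≡⟨ ℚₚ.*-distribʳ-+ ε ½ ½ ⟨
    (½ ℚ.+ ½) ℚ.* ε      ≡⟨ ℚₚ.*-identityˡ ε ⟩
    ε                    ∎
    where open ≡-Reasoning

  +-cauchy : ∀ s t → IsCauchy s → IsCauchy t → IsCauchy (λ n → s n ℚ.+ t n)
  +-cauchy s t cs ct ε ε>0 =
    let (M , p) = cs (½ ℚ.* ε) (half-pos ε ε>0)
        (N , q) = ct (½ ℚ.* ε) (half-pos ε ε>0)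
    in M ℕ.⊔ N , λ m n m≥ n≥ → begin-strict
      ℚ.∣ (s m ℚ.+ t m) ℚ.- (s n ℚ.+ t n) ∣
        ≡⟨ cong ℚ.∣_∣ (rearrange (s m) (t m) (s n) (t n)) ⟩
      ℚ.∣ (s m ℚ.- s n) ℚ.+ (t m ℚ.- t n) ∣
        ≤⟨ ℚₚ.∣p+q∣≤∣p∣+∣q∣ (s m ℚ.- s n) (t m ℚ.- t n) ⟩
      ℚ.∣ s m ℚ.- s n ∣ ℚ.+ ℚ.∣ t m ℚ.- t n ∣
        <⟨ ℚₚ.+-mono-< (p m n (ℕₚ.m⊔n≤o⇒m≤o M N m≥) (ℕₚ.m⊔n≤o⇒m≤o M N n≥))
                       (q m n (ℕₚ.m⊔n≤o⇒n≤o M N m≥) (ℕₚ.m⊔n≤o⇒n≤o M N n≥)) ⟩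
      ½ ℚ.* ε ℚ.+ ½ ℚ.* ε
        ≡⟨ half+half ε ⟩
      ε ∎
    where
    open ℚₚ.≤-Reasoning
    rearrange : ∀ a b c d → (a ℚ.+ b) ℚ.- (c ℚ.+ d) ≡ (a ℚ.- c) ℚ.+ (b ℚ.- d)
    rearrange = solve 4 (λ a b c d → (a :+ b) :- (c :+ d) := (a :- c) :+ (b :- d)) refl
      where open +-*-Solver

  eventually-bounded : ∀ s → IsCauchy s →
    ∃[ B ] 0ℚ ℚ.< B × (∃[ N ] ∀ n → N ℕ.≤ n → ℚ.∣ s n ∣ ℚ.< B)
  eventually-bounded s cs with cs 1ℚ (ℚₚ.positive⁻¹ 1ℚ)
  ... | N , p = 1ℚ ℚ.+ ℚ.∣ s N ∣ , B>0 , N , bound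
    where
    open ℚₚ.≤-Reasoning
    B>0 : 0ℚ ℚ.< 1ℚ ℚ.+ ℚ.∣ s N ∣
    B>0 = ℚₚ.+-mono-<-≤ (ℚₚ.positive⁻¹ 1ℚ) (ℚₚ.0≤∣p∣ (s N))
    recombine : ∀ a b → a ≡ (a ℚ.- b) ℚ.+ b
    recombine = solve 2 (λ a b → a := (a :- b) :+ b) refl
      where open +-*-Solver
    bound : ∀ n → N ℕ.≤ n → ℚ.∣ s n ∣ ℚ.< 1ℚ ℚ.+ ℚ.∣ s N ∣
    bound n n≥ = begin-strict
      ℚ.∣ s n ∣                          ≡⟨ cong ℚ.∣_∣ (recombine (s n) (s N)) ⟩
      ℚ.∣ (s n ℚ.- s N) ℚ.+ s N ∣        ≤⟨ ℚₚ.∣p+q∣≤∣p∣+∣q∣ (s n ℚ.- s N) (s N) ⟩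
      ℚ.∣ s n ℚ.- s N ∣ ℚ.+ ℚ.∣ s N ∣    <⟨ ℚₚ.+-monoˡ-< ℚ.∣ s N ∣ (p n N n≥ ℕₚ.≤-refl) ⟩
      1ℚ ℚ.+ ℚ.∣ s N ∣                   ∎

  small-product : ∀ B → 0ℚ ℚ.< B → ∀ ε → 0ℚ ℚ.< ε →
    ∃[ δ ] 0ℚ ℚ.< δ × (∀ x y → ℚ.∣ x ∣ ℚ.< B → ℚ.∣ y ∣ ℚ.< δ → ℚ.∣ x ℚ.* y ∣ ℚ.≤ ½ ℚ.* ε)
  small-product B B>0 ε ε>0 = δ , δ>0 , small
    where
    open ℚₚ.≤-Reasoning
    instance
      B-pos : ℚ.Positive B
      B-pos = ℚ.positive B>0
      B≢0 : ℚ.NonZero B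
      B≢0 = ℚₚ.pos⇒nonZero B
      B-nonNeg : ℚ.NonNegative B
      B-nonNeg = ℚₚ.pos⇒nonNeg B
      1/B-pos : ℚ.Positive (ℚ.1/ B)
      1/B-pos = ℚₚ.1/pos⇒pos B
    δ : ℚ
    δ = ℚ.1/ B ℚ.* (½ ℚ.* ε)
    δ>0 : 0ℚ ℚ.< δ
    δ>0 = subst (ℚ._< δ) (ℚₚ.*-zeroʳ (ℚ.1/ B)) (ℚₚ.*-monoʳ-<-pos (ℚ.1/ B) (half-pos ε ε>0))
    small : ∀ x y → ℚ.∣ x ∣ ℚ.< B → ℚ.∣ y ∣ ℚ.< δ → ℚ.∣ x ℚ.* y ∣ ℚ.≤ ½ ℚ.* ε
    small x y x<B y<δ = begin
      ℚ.∣ x ℚ.* y ∣                    ≡⟨ ℚₚ.∣p*q∣≡∣p∣*∣q∣ x y ⟩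
      ℚ.∣ x ∣ ℚ.* ℚ.∣ y ∣              ≤⟨ ℚₚ.*-monoʳ-≤-nonNeg ℚ.∣ y ∣ {{ℚₚ.∣-∣-nonNeg y}} (ℚₚ.<⇒≤ x<B) ⟩
      B ℚ.* ℚ.∣ y ∣                    ≤⟨ ℚₚ.*-monoˡ-≤-nonNeg B (ℚₚ.<⇒≤ y<δ) ⟩
      B ℚ.* (ℚ.1/ B ℚ.* (½ ℚ.* ε))     ≡⟨ ℚₚ.*-assoc B (ℚ.1/ B) (½ ℚ.* ε) ⟨
      (B ℚ.* ℚ.1/ B) ℚ.* (½ ℚ.* ε)     ≡⟨ cong (ℚ._* (½ ℚ.* ε)) (ℚₚ.*-inverseʳ B) ⟩
      1ℚ ℚ.* (½ ℚ.* ε)                 ≡⟨ ℚₚ.*-identityˡ (½ ℚ.* ε) ⟩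
      ½ ℚ.* ε                          ∎

  *-cauchy : ∀ s t → IsCauchy s → IsCauchy t → IsCauchy (λ n → s n ℚ.* t n)
  *-cauchy s t cs ct ε ε>0 =
    let (B , B>0 , K , bs) = eventually-bounded s cs
        (C , C>0 , L , bt) = eventually-bounded t ct
        (δ , δ>0 , smallˢ) = small-product B B>0 (½ ℚ.* ε) (half-pos ε ε>0)
        (η , η>0 , smallᵗ) = small-product C C>0 ε ε>0
        (M , p) = ct δ δ>0
        (N , q) = cs η η>0
        left  = λ k (k≥ : (K ℕ.⊔ L) ℕ.⊔ (M ℕ.⊔ N) ℕ.≤ k) → ℕₚ.m⊔n≤o⇒m≤o (K ℕ.⊔ L) (M ℕ.⊔ N) k≥
        right = λ k (k≥ : (K ℕ.⊔ L) ℕ.⊔ (M ℕ.⊔ N) ℕ.≤ k) → ℕₚ.m⊔n≤o⇒n≤o (K ℕ.⊔ L) (M ℕ.⊔ N) k≥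
    in (K ℕ.⊔ L) ℕ.⊔ (M ℕ.⊔ N) , λ m n m≥ n≥ → begin-strict
      ℚ.∣ (s m ℚ.* t m) ℚ.- (s n ℚ.* t n) ∣
        ≡⟨ cong ℚ.∣_∣ (rearrange (s m) (t m) (s n) (t n)) ⟩
      ℚ.∣ s m ℚ.* (t m ℚ.- t n) ℚ.+ t n ℚ.* (s m ℚ.- s n) ∣
        ≤⟨ ℚₚ.∣p+q∣≤∣p∣+∣q∣ (s m ℚ.* (t m ℚ.- t n)) (t n ℚ.* (s m ℚ.- s n)) ⟩
      ℚ.∣ s m ℚ.* (t m ℚ.- t n) ∣ ℚ.+ ℚ.∣ t n ℚ.* (s m ℚ.- s n) ∣
        ≤⟨ ℚₚ.+-mono-≤
             (smallˢ (s m) (t m ℚ.- t n) (bs m (ℕₚ.m⊔n≤o⇒m≤o K L (left m m≥)))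
               (p m n (ℕₚ.m⊔n≤o⇒m≤o M N (right m m≥)) (ℕₚ.m⊔n≤o⇒m≤o M N (right n n≥))))
             (smallᵗ (t n) (s m ℚ.- s n) (bt n (ℕₚ.m⊔n≤o⇒n≤o K L (left n n≥)))
               (q m n (ℕₚ.m⊔n≤o⇒n≤o M N (right m m≥)) (ℕₚ.m⊔n≤o⇒n≤o M N (right n n≥)))) ⟩
      ½ ℚ.* (½ ℚ.* ε) ℚ.+ ½ ℚ.* ε
        <⟨ ℚₚ.+-monoˡ-< (½ ℚ.* ε) (halving (½ ℚ.* ε) (half-pos ε ε>0)) ⟩
      ½ ℚ.* ε ℚ.+ ½ ℚ.* ε
        ≡⟨ half+half ε ⟩
      ε ∎
    where
    open ℚₚ.≤-Reasoning
    rearrange : ∀ a b c d → (a ℚ.* b) ℚ.- (c ℚ.* d) ≡ a ℚ.* (b ℚ.- d) ℚ.+ d ℚ.* (a ℚ.- c)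
    rearrange = solve 4 (λ a b c d → (a :* b) :- (c :* d) := a :* (b :- d) :+ d :* (a :- c)) refl
      where open +-*-Solver
    halving : ∀ x → 0ℚ ℚ.< x → ½ ℚ.* x ℚ.< x
    halving x x>0 = begin-strict
      ½ ℚ.* x              ≡⟨ ℚₚ.+-identityʳ (½ ℚ.* x) ⟨
      ½ ℚ.* x ℚ.+ 0ℚ       <⟨ ℚₚ.+-monoʳ-< (½ ℚ.* x) (half-pos x x>0) ⟩
      ½ ℚ.* x ℚ.+ ½ ℚ.* x  ≡⟨ half+half x ⟩
      x                    ∎

fromℚ : ℚ → ℝ
fromℚ q = mkℝ (λ _ → q) λ ε ε>0 → 0 , λ _ _ _ _ →
  subst (ℚ._< ε) (sym (cong ℚ.∣_∣ (ℚₚ.+-inverseʳ q))) ε>0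

0ᴿ 1ᴿ : ℝ
0ᴿ = fromℚ 0ℚ
1ᴿ = fromℚ 1ℚ

infixl 6 _+ᴿ_
infixl 7 _*ᴿ_
infix 4 _≈ᴿ_ _≤ᴿ_ _<ᴿ_

_+ᴿ_ : ℝ → ℝ → ℝ
x +ᴿ y = mkℝ (λ n → seq x n ℚ.+ seq y n) (+-cauchy (seq x) (seq y) (cauchy x) (cauchy y))

_*ᴿ_ : ℝ → ℝ → ℝ
x *ᴿ y = mkℝ (λ n → seq x n ℚ.* seq y n) (*-cauchy (seq x) (seq y) (cauchy x) (cauchy y))

_≈ᴿ_ : Rel ℝ 0ℓ
x ≈ᴿ y = ∀ ε → 0ℚ ℚ.< ε → ∃[ N ] ∀ n → N ℕ.≤ n → ℚ.∣ seq x n ℚ.- seq y n ∣ ℚ.< ε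

_≤ᴿ_ : Rel ℝ 0ℓ
x ≤ᴿ y = ∀ ε → 0ℚ ℚ.< ε → ∃[ N ] ∀ n → N ℕ.≤ n → seq x n ℚ.≤ seq y n ℚ.+ ε

_<ᴿ_ : Rel ℝ 0ℓ
x <ᴿ y = ∃[ ε ] 0ℚ ℚ.< ε × (∃[ N ] ∀ n → N ℕ.≤ n → seq x n ℚ.+ ε ℚ.≤ seq y n)

∣_-_∣<_ : ℝ → ℝ → ℚ → Set
∣ x - y ∣< ε = (x <ᴿ y +ᴿ fromℚ ε) × (y <ᴿ x +ᴿ fromℚ ε)

-- e enumerates, without repetition, the elements of P up to the
-- equality of the setoid.
record HasCardinality {a ℓ p} (A : Setoid a ℓ) (P : Pred (Setoid.Carrier A) p) (n : ℕ)
  : Set (a ⊔ ℓ ⊔ p) where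
  open Setoid A
  field
    e          : Fin n → Carrier
    e-in       : ∀ i → P (e i)
    injective  : ∀ {i j} → e i ≈ e j → i ≡ j
    surjective : ∀ {x} → P x → ∃[ i ] e i ≈ x

Infinite : ∀ {a ℓ p} (A : Setoid a ℓ) → Pred (Setoid.Carrier A) p → Set (a ⊔ ℓ ⊔ p)
Infinite A P = ¬ (∃[ n ] HasCardinality A P n)

vectorSetoid : ∀ {a ℓ} → Setoid a ℓ → ℕ → Setoid a ℓ
vectorSetoid A m = record
  { Carrier       = Vector Carrier m
  ; _≈_           = λ x y → ∀ i → x i ≈ y i
  ; isEquivalence = record
    { refl  = λ i → Setoid.refl A
    ; sym   = λ p i → Setoid.sym A (p i)
    ; trans = λ p q i → Setoid.trans A (p i) (q i)
    }
  }
  where open Setoid A using (Carrier; _≈_)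

module _ {a b ℓ₁ ℓ₂} (R : CommutativeRing a ℓ₁) (R′ : CommutativeRing b ℓ₂) where
  private
    module R = CommutativeRing R
    module R′ = CommutativeRing R′
  open Morphism.RingMorphisms R.rawRing R′.rawRing public
    using () renaming (IsRingHomomorphism to IsHom; IsRingMonomorphism to IsEmbedding)

module RingDefinitions {c ℓ} (R : CommutativeRing c ℓ) where
  open CommutativeRing R
  open RawSemiringDefinitions (Semiring.rawSemiring semiring) public
    using (_∣_; Irreducible; sum; product)

  IsUnit : Pred Carrier (c ⊔ ℓ)
  IsUnit x = x ∣ 1#

  record IsField : Set (c ⊔ ℓ) where
    field
      1≉0      : ¬ (1# ≈ 0#)
      inverses : ∀ x → ¬ (x ≈ 0#) → ∃[ y ] x * y ≈ 1#

  record IsPrimeIdeal {p} (P : Pred Carrier p) : Set (c ⊔ p) where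
    field
      proper : ¬ P 1#
      prime  : ∀ x y → P (x * y) → P x ⊎ P y

  IsPrimeElement : Pred Carrier (c ⊔ ℓ)
  IsPrimeElement x = Irreducible x × IsPrimeIdeal (x ∣_)

  -- Coefficient lists, constant term first.
  Poly : Set c
  Poly = List Carrier

  coefficient : Poly → ℕ → Carrier
  coefficient []      _       = 0#
  coefficient (a ∷ _) zero    = a
  coefficient (_ ∷ p) (suc n) = coefficient p n

  infix 4 _≈ₚ_
  infixl 6 _+ₚ_
  infixl 7 _*ₚ_

  -- Lists differing by trailing zeros represent the same polynomial.
  _≈ₚ_ : Rel Poly ℓ
  p ≈ₚ q = ∀ n → coefficient p n ≈ coefficient q n

  _+ₚ_ : Poly → Poly → Poly
  []      +ₚ q       = q
  (a ∷ p) +ₚ []      = a ∷ p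
  (a ∷ p) +ₚ (b ∷ q) = a + b ∷ p +ₚ q

  _*ₚ_ : Poly → Poly → Poly
  []      *ₚ q = []
  (a ∷ p) *ₚ q = map (a *_) q +ₚ (0# ∷ p *ₚ q)

  polynomials : RawSemiring c ℓ
  polynomials = record
    { Carrier = Poly ; _≈_ = _≈ₚ_ ; _+_ = _+ₚ_ ; _*_ = _*ₚ_ ; 0# = [] ; 1# = 1# ∷ [] }

  open RawSemiringDefinitions polynomials public
    using () renaming (_∣_ to _∣ₚ_; Irreducible to IsIrreducibleₚ; product to productₚ)

  Associate : Rel Poly (c ⊔ ℓ)
  Associate p q = ∃[ u ] (u ∣ₚ (1# ∷ [])) × (p ≈ₚ u *ₚ q)

  X-_ : Carrier → Poly
  X- a = - a ∷ 1# ∷ []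

  eval : Poly → Carrier → Carrier
  eval []      x = 0#
  eval (a ∷ p) x = a + x * eval p x

open RingDefinitions using (IsField; Poly; eval)

Ring₀ : Set₁
Ring₀ = CommutativeRing 0ℓ 0ℓ

record FiniteExtension (K L : Ring₀) : Set where
  private
    module K = CommutativeRing K
    module L = CommutativeRing L
  open RingDefinitions L using (sum)
  field
    φ         : K.Carrier → L.Carrier
    isHom     : IsHom K L φ
    dimension : ℕ
    generator : Fin dimension → L.Carrier
    spanning  : ∀ x → Σ (Fin dimension → K.Carrier) λ c →
                x L.≈ sum (λ i → φ (c i) L.* generator i)

IsFiniteField : Ring₀ → Set
IsFiniteField k = IsField k × ∃[ n ] HasCardinality (CommutativeRing.setoid k) U n

record IsRationalFunctionField (k K : Ring₀) : Set where
  private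
    module k = CommutativeRing k
    module K = CommutativeRing K
  open RingDefinitions k using (_≈ₚ_)
  field
    isField        : IsField K
    φ              : k.Carrier → K.Carrier
    isHom          : IsHom k K φ
    t              : K.Carrier
    transcendental : ∀ p → eval K (map φ p) t K.≈ K.0# → p ≈ₚ []
    fractions      : ∀ x → ∃[ p ] ∃[ q ]
                     ¬ (q ≈ₚ []) × (eval K (map φ q) t K.* x K.≈ eval K (map φ p) t)

record IsGlobalField (F : Ring₀) : Set₁ where
  field
    isField : IsField F
    finite  : FiniteExtension ℚₚ.+-*-commutativeRing F
            ⊎ (∃[ k ] ∃[ K ] IsFiniteField k × IsRationalFunctionField k K × FiniteExtension K F)

CharacteristicTwo : Pred Ring₀ 0ℓ
CharacteristicTwo F = 1# + 1# ≈ 0#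
  where open CommutativeRing F

module _ (F : Ring₀) where
  open CommutativeRing F

  record AbsoluteValue : Set where
    field
      ∣_∣        : Carrier → ℝ
      cong-≈     : ∀ {x y} → x ≈ y → ∣ x ∣ ≈ᴿ ∣ y ∣
      nonNeg     : ∀ x → 0ᴿ ≤ᴿ ∣ x ∣
      definite   : ∀ x → (∣ x ∣ ≈ᴿ 0ᴿ) ⇔ (x ≈ 0#)
      mult       : ∀ x y → ∣ x * y ∣ ≈ᴿ ∣ x ∣ *ᴿ ∣ y ∣
      triangle   : ∀ x y → ∣ x + y ∣ ≤ᴿ ∣ x ∣ +ᴿ ∣ y ∣
      nontrivial : ∃[ x ] ¬ (x ≈ 0#) × ¬ (∣ x ∣ ≈ᴿ 1ᴿ)

  open AbsoluteValue

  NonArchimedean : Pred AbsoluteValue 0ℓ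
  NonArchimedean v = ∀ x y r → ∣ v ∣ x ≤ᴿ r → ∣ v ∣ y ≤ᴿ r → ∣ v ∣ (x + y) ≤ᴿ r

  -- The topology of w is finer than that of v; by translation it
  -- suffices to compare neighbourhoods of 0.
  Finer : Rel AbsoluteValue 0ℓ
  Finer w v = ∀ ε → 0ℚ ℚ.< ε → ∃[ δ ] 0ℚ ℚ.< δ ×
    (∀ x → ∣ w ∣ x <ᴿ fromℚ δ → ∣ v ∣ x <ᴿ fromℚ ε)

  -- A place is a class of absolute values for this relation, and is
  -- given below by a representative.
  Equivalent : Rel AbsoluteValue 0ℓ
  Equivalent v w = Finer v w × Finer w v

  _∈ₚ_ : AbsoluteValue → List AbsoluteValue → Set
  v ∈ₚ 𝒮 = Any (Equivalent v) 𝒮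

  ContainsArchimedean : List AbsoluteValue → Set
  ContainsArchimedean 𝒮 = ∀ v → ¬ NonArchimedean v → v ∈ₚ 𝒮

  IsSInteger : List AbsoluteValue → Pred Carrier 0ℓ
  IsSInteger 𝒮 x = ∀ v → ¬ (v ∈ₚ 𝒮) → ∣ v ∣ x ≤ᴿ 1ᴿ

record IsRingOfSIntegers (F : Ring₀) (𝒮 : List (AbsoluteValue F)) (D : Ring₀)
  (ι : CommutativeRing.Carrier D → CommutativeRing.Carrier F) : Set where
  open CommutativeRing F using (_≈_)
  field
    embedding : IsEmbedding D F ι
    image     : ∀ x → (∃[ a ] ι a ≈ x) ⇔ IsSInteger F 𝒮 x

module _ (D : Ring₀) where
  open CommutativeRing D renaming (refl to ≈-refl; sym to ≈-sym; trans to ≈-trans)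
  open RingDefinitions D using (sum)
  open RingProperties ring using (-1*x≈-x; -‿involutive; -‿+-comm; x[y-z]≈xy-xz; [y-z]x≈yx-zx)

  record Ideal : Set₁ where
    field
      member   : Pred Carrier 0ℓ
      resp     : ∀ {x y} → x ≈ y → member x → member y
      0-closed : member 0#
      +-closed : ∀ {x y} → member x → member y → member (x + y)
      *-closed : ∀ r {x} → member x → member (r * x)

  open Ideal

  record NonzeroIdeal : Set₁ where
    field
      ideal   : Ideal
      nonzero : ∃[ x ] member ideal x × ¬ (x ≈ 0#)

  open NonzeroIdeal

  InProduct : Ideal → Ideal → Pred Carrier 0ℓ
  InProduct I J x = ∃[ n ] Σ (Vector Carrier n) λ a → Σ (Vector Carrier n) λ b →
    (∀ i → member I (a i)) × (∀ i → member J (b i)) × (x ≈ sum (λ i → a i * b i))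

  Divides : Rel NonzeroIdeal (lsuc 0ℓ)
  Divides n m = ∃[ J ] ∀ x → member (ideal m) x ⇔ InProduct (ideal n) J x

  Congruent : NonzeroIdeal → Rel Carrier 0ℓ
  Congruent n x y = member (ideal n) (x - y)

  private
    module Cong (n : NonzeroIdeal) where
      open import Relation.Binary.Reasoning.Setoid setoid
      I = ideal n

      telescope : ∀ x y z → (x - y) + (y - z) ≈ x - z
      telescope x y z = begin
        (x - y) + (y - z)      ≈⟨ +-assoc x (- y) (y - z) ⟩
        x + (- y + (y - z))    ≈⟨ +-congˡ (+-assoc (- y) y (- z)) ⟨
        x + ((- y + y) - z)    ≈⟨ +-congˡ (+-congʳ (-‿inverseˡ y)) ⟩
        x + (0# - z)           ≈⟨ +-congˡ (+-identityˡ (- z)) ⟩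
        x - z                  ∎

      neg-closed : ∀ {x} → member I x → member I (- x)
      neg-closed {x} p = resp I (-1*x≈-x x) (*-closed I (- 1#) p)

      swap : ∀ x y → - (x - y) ≈ y - x
      swap x y = begin
        - (x - y)      ≈⟨ -‿+-comm x (- y) ⟨
        - x + - (- y)  ≈⟨ +-congˡ (-‿involutive y) ⟩
        - x + y        ≈⟨ +-comm (- x) y ⟩
        y - x          ∎

      c-reflexive : ∀ {x y} → x ≈ y → Congruent n x y
      c-reflexive {x} {y} p =
        resp I (≈-sym (≈-trans (+-congʳ p) (-‿inverseʳ y))) (0-closed I)

      c-sym : ∀ {x y} → Congruent n x y → Congruent n y x
      c-sym {x} {y} p = resp I (swap x y) (neg-closed p)

      c-trans : ∀ {x y z} → Congruent n x y → Congruent n y z → Congruent n x z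
      c-trans {x} {y} {z} p q = resp I (telescope x y z) (+-closed I p q)

      c-neg : ∀ {x y} → Congruent n x y → Congruent n (- x) (- y)
      c-neg {x} {y} p = resp I (≈-sym (-‿+-comm x (- y))) (neg-closed p)

      c-+ˡ : ∀ x {y z} → Congruent n y z → Congruent n (x + y) (x + z)
      c-+ˡ x {y} {z} p = resp I eq p
        where
        eq : y - z ≈ (x + y) - (x + z)
        eq = begin
          y - z                    ≈⟨ +-identityˡ (y - z) ⟨
          0# + (y - z)             ≈⟨ +-congʳ (-‿inverseˡ x) ⟨
          (- x + x) + (y - z)      ≈⟨ +-assoc (- x) x (y - z) ⟩
          - x + (x + (y - z))      ≈⟨ +-congˡ (+-assoc x y (- z)) ⟨
          - x + ((x + y) - z)      ≈⟨ +-comm (- x) ((x + y) - z) ⟩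
          ((x + y) - z) - x        ≈⟨ +-assoc (x + y) (- z) (- x) ⟩
          (x + y) + (- z - x)      ≈⟨ +-congˡ (+-comm (- z) (- x)) ⟩
          (x + y) + (- x - z)      ≈⟨ +-congˡ (-‿+-comm x z) ⟩
          (x + y) - (x + z)        ∎

      c-+ : ∀ {x y u v} → Congruent n x y → Congruent n u v → Congruent n (x + u) (y + v)
      c-+ {x} {y} {u} {v} p q = c-trans (c-+ˡ x q)
        (c-trans (c-reflexive (+-comm x v)) (c-trans (c-+ˡ v p) (c-reflexive (+-comm v y))))

      c-*ˡ : ∀ x {y z} → Congruent n y z → Congruent n (x * y) (x * z)
      c-*ˡ x {y} {z} p = resp I (x[y-z]≈xy-xz x y z) (*-closed I x p)

      c-* : ∀ {x y u v} → Congruent n x y → Congruent n u v → Congruent n (x * u) (y * v)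
      c-* {x} {y} {u} {v} p q = c-trans (c-*ˡ x q)
        (c-trans (c-reflexive (*-comm x v)) (c-trans (c-*ˡ v p) (c-reflexive (*-comm v y))))

  quotient : NonzeroIdeal → Setoid 0ℓ 0ℓ
  quotient n = record
    { Carrier       = Carrier
    ; _≈_           = Congruent n
    ; isEquivalence = record { refl = c-reflexive ≈-refl ; sym = c-sym ; trans = c-trans }
    }
    where open Cong n

  -- An element of the inverse limit of the rings D/n, by
  -- representatives in D; two of them are equal when they have the
  -- same residue modulo every n.
  record Profinite : Set₁ where
    constructor mkProfinite
    field
      at         : NonzeroIdeal → Carrier
      compatible : ∀ n m → (∀ {x} → member (ideal m) x → member (ideal n) x) →
                   Congruent n (at m) (at n)

  open Profinite

  completion : CommutativeRing (lsuc 0ℓ) (lsuc 0ℓ)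
  completion = record
    { Carrier = Profinite
    ; _≈_     = _≋_
    ; _+_     = λ x y → mkProfinite (λ n → at x n + at y n)
                  (λ n m i → Cong.c-+ n (compatible x n m i) (compatible y n m i))
    ; _*_     = λ x y → mkProfinite (λ n → at x n * at y n)
                  (λ n m i → Cong.c-* n (compatible x n m i) (compatible y n m i))
    ; -_      = λ x → mkProfinite (λ n → - at x n) (λ n m i → Cong.c-neg n (compatible x n m i))
    ; 0#      = constant 0#
    ; 1#      = constant 1#
    ; isCommutativeRing = record
      { isRing = record
        { +-isAbelianGroup = record
          { isGroup = record
            { isMonoid = record
              { isSemigroup = record
                { isMagma = record
                  { isEquivalence = record
                    { refl  = λ n → Cong.c-reflexive n ≈-refl
                    ; sym   = λ p n → Cong.c-sym n (p n)
                    ; trans = λ p q n → Cong.c-trans n (p n) (q n)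
                    }
                  ; ∙-cong = λ p q n → Cong.c-+ n (p n) (q n)
                  }
                ; assoc = λ x y z → pointwise λ n → +-assoc (at x n) (at y n) (at z n)
                }
              ; identity = (λ x → pointwise λ n → +-identityˡ (at x n))
                         , (λ x → pointwise λ n → +-identityʳ (at x n))
              }
            ; inverse = (λ x → pointwise λ n → -‿inverseˡ (at x n))
                      , (λ x → pointwise λ n → -‿inverseʳ (at x n))
            ; ⁻¹-cong = λ p n → Cong.c-neg n (p n)
            }
          ; comm = λ x y → pointwise λ n → +-comm (at x n) (at y n)
          }
        ; *-cong = λ p q n → Cong.c-* n (p n) (q n)
        ; *-assoc = λ x y z → pointwise λ n → *-assoc (at x n) (at y n) (at z n)
        ; *-identity = (λ x → pointwise λ n → *-identityˡ (at x n))
                     , (λ x → pointwise λ n → *-identityʳ (at x n))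
        ; distrib = (λ x y z → pointwise λ n → distribˡ (at x n) (at y n) (at z n))
                  , (λ x y z → pointwise λ n → distribʳ (at x n) (at y n) (at z n))
        }
      ; *-comm = λ x y → pointwise λ n → *-comm (at x n) (at y n)
      }
    }
    where
    _≋_ : Rel Profinite (lsuc 0ℓ)
    x ≋ y = ∀ n → Congruent n (at x n) (at y n)
    constant : Carrier → Profinite
    constant a = mkProfinite (λ _ → a) (λ n _ _ → Cong.c-reflexive n ≈-refl)
    pointwise : ∀ {f g : NonzeroIdeal → Carrier} → (∀ n → f n ≈ g n) →
                ∀ n → Congruent n (f n) (g n)
    pointwise p n = Cong.c-reflexive n (p n)

  embed : Carrier → Profinite
  embed a = mkProfinite (λ _ → a) (λ n _ _ → Cong.c-reflexive n ≈-refl)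

open Ideal public
open NonzeroIdeal public
open Profinite public

module _ (D : Ring₀) where
  private
    module D̂ = CommutativeRing (completion D)

  Power : ℕ → Set₁
  Power m = Vector (Profinite D) m

  Subset : ℕ → Set₂
  Subset m = Pred (Power m) (lsuc 0ℓ)

  module _ {m : ℕ} where

    _≡_[mod_] : Power m → Power m → NonzeroIdeal D → Set
    x ≡ y [mod n ] = ∀ i → Congruent D n (at (x i) n) (at (y i) n)

    -- The cosets of the groups n D̂ᵐ, that is the fibres of the maps to
    -- (D/n)ᵐ, form a basis of the topology.
    IsOpen : Pred (Subset m) (lsuc 0ℓ)
    IsOpen V = ∀ x → V x → ∃[ n ] ∀ y → x ≡ y [mod n ] → V y

    IsCompact : Pred (Subset m) (lsuc (lsuc 0ℓ))
    IsCompact V = ∀ {I : Set₁} (C : I → Subset m) → (∀ i → IsOpen (C i)) →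
      (∀ x → V x → ∃[ i ] C i x) →
      ∃[ is ] ∀ x → V x → Any (λ i → C i x) is

    -- The image π̂ₙ(S) in (D/n)ᵐ; Saturation is its preimage in D̂ᵐ.
    Residues : NonzeroIdeal D → Subset m → Pred (Vector (CommutativeRing.Carrier D) m) (lsuc 0ℓ)
    Residues n S z = ∃[ x ] S x × (∀ i → Congruent D n (at (x i) n) (z i))

    Saturation : NonzeroIdeal D → Subset m → Subset m
    Saturation n S y = Residues n S (λ i → at (y i) n)

  record CompactOpen (m : ℕ) : Set₂ where
    field
      set       : Subset m
      isOpen    : IsOpen set
      isCompact : IsCompact set

  open CompactOpen using (set)

  -- Borel measures enter only through their values on compact open
  -- sets, on which countable additivity reduces to finite additivity.
  record HaarMeasure (m : ℕ) : Set₂ where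
    field
      measure    : CompactOpen m → ℝ
      nonNeg     : ∀ V → 0ᴿ ≤ᴿ measure V
      additive   : ∀ V₁ V₂ W →
                   (∀ x → ¬ (set V₁ x × set V₂ x)) →
                   (∀ x → set W x ⇔ (set V₁ x ⊎ set V₂ x)) →
                   measure W ≈ᴿ measure V₁ +ᴿ measure V₂
      invariant  : ∀ (a : Power m) V W →
                   (∀ x → set V x ⇔ set W (λ i → a i D̂.+ x i)) →
                   measure V ≈ᴿ measure W
      normalized : ∀ V → (∀ x → set V x) → measure V ≈ᴿ 1ᴿ

  open HaarMeasure using (measure)

  -- Truncated μ S n V v says that the measure attached to S and n takes
  -- the value v on V.  A relation is used because cardinalities of
  -- arbitrary sets are not computable; it determines v.
  data Truncated {m} (μ : HaarMeasure m) (S : Subset m) (n : NonzeroIdeal D)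
    (V : CompactOpen m) (v : ℝ) : Set₂ where
    empty    : (∀ x → ¬ S x) → v ≈ᴿ 0ᴿ → Truncated μ S n V v
    nonempty : ∃ S → (N M : ℕ) .{{_ : NonZero M}} →
               HasCardinality (quotient D n) U N →
               HasCardinality (vectorSetoid (quotient D n) m) (Residues n S) M →
               (W : CompactOpen m) →
               (∀ x → set W x ⇔ (set V ∩ Saturation n S) x) →
               v ≈ᴿ fromℚ ((+ (N ℕ.^ m)) ℚ./ M) *ᴿ measure μ W →
               Truncated μ S n V v

  -- Convergence along the non-zero ideals ordered by divisibility.
  _⟶_ : (NonzeroIdeal D → ℝ → Set₂) → ℝ → Set₂
  a ⟶ l = ∀ ε → 0ℚ ℚ.< ε → ∃[ n₀ ] ∀ n → Divides D n₀ n →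
    ∃[ v ] a n v × ∣ v - l ∣< ε

  -- ν is the weak-* limit of the truncated measures of S; being the
  -- limit of additive functions on compact open sets, it is additive.
  IsProcountingMeasure : ∀ {m} → HaarMeasure m → Subset m → (CompactOpen m → ℝ) → Set₂
  IsProcountingMeasure μ S ν = ∀ V → (λ n → Truncated μ S n V) ⟶ ν V

module _ (F D : Ring₀) (ι : CommutativeRing.Carrier D → CommutativeRing.Carrier F) where
  private
    module D = CommutativeRing D
    module D̂ = CommutativeRing (completion D)
  open RingDefinitions D using (Associate; IsPrimeElement; IsIrreducibleₚ; productₚ)
  open RingDefinitions (completion D) using () renaming (IsUnit to IsUnit^)

  -- No extension field of F contains a multiple root of f.
  IsSeparable : Pred (Poly D) (lsuc 0ℓ)
  IsSeparable f = ∀ (L : Ring₀) → IsField L → ∀ φ → IsHom F L φ → ∀ a →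
    let open RingDefinitions L using (X-_; _*ₚ_; _∣ₚ_) in
    ¬ (((X- a) *ₚ (X- a)) ∣ₚ map (φ ∘ ι) f)

  evalD̂ : Poly D → Profinite D → Profinite D
  evalD̂ f = eval (completion D) (map (embed D) f)

  record IsAdmissible {k} (f : Fin k → Poly D) : Set₁ where
    field
      irreducible  : ∀ i → IsIrreducibleₚ (f i)
      separable    : ∀ i → IsSeparable (f i)
      nonAssociate : ∀ i j → i ≢ j → ¬ Associate (f i) (f j)
      unitValue    : ∃[ a ] IsUnit^ (evalD̂ (productₚ f) a)

  module _ {k} (f : Fin k → Poly D) where

    -- 𝐟|_D⁻¹(𝒫(D)ᵏ), as a subset of D̂ = D̂¹
    PrimeArguments : Subset D 1
    PrimeArguments x = ∃[ a ] (∀ i → IsPrimeElement (eval D (f i) a)) × (x zero D̂.≈ embed D a)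

    -- 𝐟⁻¹((D̂*)ᵏ), as a subset of D̂ = D̂¹
    UnitArguments : Subset D 1
    UnitArguments x = ∀ i → IsUnit^ (evalD̂ (f i) (x zero))

    -- 𝐟(D) ∩ 𝒫(D)ᵏ
    PrimeValues : Pred (Vector D.Carrier k) 0ℓ
    PrimeValues y = (∃[ a ] ∀ i → eval D (f i) a D.≈ y i) × (∀ i → IsPrimeElement (y i))

    PrimeValues^ : Subset D k
    PrimeValues^ y = ∃[ z ] PrimeValues z × (∀ i → y i D̂.≈ embed D (z i))

    -- 𝐟(D̂) ∩ (D̂*)ᵏ
    UnitValues : Subset D k
    UnitValues y = (∃[ a ] ∀ i → evalD̂ (f i) a D̂.≈ y i) × (∀ i → IsUnit^ (y i))

  ProfiniteBatemanHorn : (∀ m → HaarMeasure D m) → Set₂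
  ProfiniteBatemanHorn μ = ∀ k → 1 ℕ.≤ k → (f : Fin k → Poly D) → IsAdmissible f →
    (∃[ ν ] IsProcountingMeasure D (μ 1) (PrimeArguments f) ν
          × IsProcountingMeasure D (μ 1) (UnitArguments f) ν)
    × (∃[ ν ] IsProcountingMeasure D (μ k) (PrimeValues^ f) ν
            × IsProcountingMeasure D (μ k) (UnitValues f) ν)

  ExtendedSchinzelH : Set₁
  ExtendedSchinzelH = ∀ d → 1 ℕ.≤ d → (f : Fin d → Poly D) → IsAdmissible f →
    Infinite (vectorSetoid D.setoid d) (PrimeValues f)

{-# OPTIONS --safe #-}
module Submission where

-- Suppose that S = 𝐟(D) ∩ 𝒫(D)ᵈ is finite, let P be the product of the first
-- coordinates of its elements, and let V be the set of all y ∈ D̂ᵈ such that y₁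
-- is a unit modulo P.  Then V is compact open and misses S, because a prime
-- element is not a unit modulo its multiple P, whereas V contains
-- T = 𝐟(D̂) ∩ (D̂*)ᵈ.  As V is a union of fibres of reduction modulo P, for every
-- 𝔫 divisible by P the truncated measures of S and T give V the values 0 and 1,
-- so they have no common limit.
--
-- T is nonempty, so the existence of its truncated measures already makes the
-- quotients D/𝔫 finite.  Since D is countable, the non-zero ideals have a cofinal
-- descending sequence, and compactness of V is then König's lemma.

open import Defs
open import Algebra.Bundles using (CommutativeRing)
import Algebra.Definitions.RawMagma as RawMagmaDefinitions
import Algebra.Definitions.RawSemiring as RawSemiringDefinitions
import Algebra.Properties.CommutativeSemigroup as CommutativeSemigroupProperties
import Algebra.Properties.Monoid.Sum as MonoidSum
import Algebra.Properties.Ring as RingProperties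
import Algebra.Properties.Semiring.Divisibility as Divisibility
import Algebra.Properties.Semiring.Sum as SemiringSum
open import Axiom.ExcludedMiddle using (ExcludedMiddle)
open import Data.Empty using (⊥)
open import Data.Fin.Base using (Fin; zero; suc; toℕ; combine; finToFun; funToFin)
import Data.Fin.Properties as Finₚ
open import Data.Integer.Base as ℤ using (ℤ; +_; -[1+_])
import Data.Integer.Properties as ℤₚ
open import Data.List.Base using (List; []; _∷_; _++_; map; cartesianProductWith)
open import Data.List.Membership.Propositional using (_∈_)
open import Data.List.Membership.Propositional.Properties using (∈-cartesianProductWith⁺)
open import Data.List.Relation.Binary.Pointwise.Base using (Pointwise; []; _∷_)
open import Data.List.Relation.Unary.Any using (Any; here; there)
open import Data.List.Relation.Unary.Any.Properties using (++⁺ˡ; ++⁺ʳ)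
open import Data.Nat.Base as ℕ using (ℕ; zero; suc; NonZero; s≤s)
import Data.Nat.Properties as ℕₚ
open import Data.Product.Base using (Σ; ∃; ∃-syntax; _×_; _,_; proj₁; proj₂)
open import Data.Rational.Base as ℚ using (ℚ; mkℚ; 0ℚ; 1ℚ; ½)
import Data.Rational.Properties as ℚₚ
open import Data.Rational.Solver using (module +-*-Solver)
import Data.Rational.Unnormalised.Base as ℚᵘ
import Data.Rational.Unnormalised.Properties as ℚᵘₚ
open import Data.Sum.Base using (_⊎_; inj₁; inj₂)
open import Data.Vec.Functional using (Vector) renaming (_∷_ to _∷ᵛ_)
open import Function.Base using (_∘_; id)
open import Function.Bundles using (_⇔_; mk⇔; Equivalence)
open import Level using (0ℓ; Lift; lift) renaming (suc to lsuc)
open import Relation.Binary.Bundles using (Setoid)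
open import Relation.Binary.Core using (Rel)
open import Relation.Binary.PropositionalEquality as ≡ using (_≡_; _≢_)
import Relation.Binary.Reasoning.Setoid as SetoidReasoning
open import Relation.Nullary using (¬_; Dec; yes; no; contradiction)
open import Relation.Unary using (Pred; U; _∩_; _⊆_)

open CompactOpen using (set)
open HaarMeasure using (measure; additive; invariant; normalized)
open ℝ using (seq)

-- Real numbers

Eventually : (ℕ → Set) → Set
Eventually P = ∃[ N ] ∀ n → N ℕ.≤ n → P n

eventually-∩ : ∀ {P Q R : ℕ → Set} → (∀ n → P n → Q n → R n) →
               Eventually P → Eventually Q → Eventually R
eventually-∩ f (M , p) (N , q) = M ℕ.⊔ N , λ n n≥ →
  f n (p n (ℕₚ.m⊔n≤o⇒m≤o M N n≥)) (q n (ℕₚ.m⊔n≤o⇒n≤o M N n≥))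

half : ∀ {ε} → 0ℚ ℚ.< ε → 0ℚ ℚ.< ½ ℚ.* ε
half {ε} ε>0 = ≡.subst (ℚ._< ½ ℚ.* ε) (ℚₚ.*-zeroʳ ½) (ℚₚ.*-monoʳ-<-pos ½ ε>0)

halves : ∀ ε → ½ ℚ.* ε ℚ.+ ½ ℚ.* ε ≡ ε
halves = solve 1 (λ e → con ½ :* e :+ con ½ :* e := e) ≡.refl
  where open +-*-Solver

≡⇒≈ᴿ : ∀ {x y} → (∀ n → seq x n ≡ seq y n) → x ≈ᴿ y
≡⇒≈ᴿ {x} {y} p ε ε>0 = 0 , λ n _ →
  ≡.subst (ℚ._< ε) (≡.cong ℚ.∣_∣ (≡.sym
    (≡.trans (≡.cong (ℚ._- seq y n) (p n)) (ℚₚ.+-inverseʳ (seq y n))))) ε>0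

∣p-q∣≡∣q-p∣ : ∀ p q → ℚ.∣ p ℚ.- q ∣ ≡ ℚ.∣ q ℚ.- p ∣
∣p-q∣≡∣q-p∣ p q = ≡.trans (≡.sym (ℚₚ.∣-p∣≡∣p∣ (p ℚ.- q))) (≡.cong ℚ.∣_∣ (swap p q))
  where
  open +-*-Solver
  swap : ∀ p q → ℚ.- (p ℚ.- q) ≡ q ℚ.- p
  swap = solve 2 (λ p q → :- (p :- q) := q :- p) ≡.refl

≈ᴿ-sym : ∀ {x y} → x ≈ᴿ y → y ≈ᴿ x
≈ᴿ-sym {x} {y} p ε ε>0 with p ε ε>0
... | N , q = N , λ n n≥ → ≡.subst (ℚ._< ε) (∣p-q∣≡∣q-p∣ (seq x n) (seq y n)) (q n n≥)

triangle-split : ∀ {ε a b} c d → ℚ.∣ a ∣ ℚ.< ½ ℚ.* ε → ℚ.∣ b ∣ ℚ.< ½ ℚ.* ε → c ℚ.- d ≡ a ℚ.+ b →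
                 ℚ.∣ c ℚ.- d ∣ ℚ.< ε
triangle-split {ε} {a} {b} c d a< b< eq = begin-strict
  ℚ.∣ c ℚ.- d ∣            ≡⟨ ≡.cong ℚ.∣_∣ eq ⟩
  ℚ.∣ a ℚ.+ b ∣            ≤⟨ ℚₚ.∣p+q∣≤∣p∣+∣q∣ a b ⟩
  ℚ.∣ a ∣ ℚ.+ ℚ.∣ b ∣      <⟨ ℚₚ.+-mono-< a< b< ⟩
  ½ ℚ.* ε ℚ.+ ½ ℚ.* ε      ≡⟨ halves ε ⟩
  ε                        ∎
  where open ℚₚ.≤-Reasoning

≈ᴿ-trans : ∀ {x y z} → x ≈ᴿ y → y ≈ᴿ z → x ≈ᴿ z
≈ᴿ-trans {x} {y} {z} p q ε ε>0 = eventually-∩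
  (λ n a b → triangle-split (seq x n) (seq z n) a b (telescope (seq x n) (seq y n) (seq z n)))
  (p _ (half ε>0)) (q _ (half ε>0))
  where
  open +-*-Solver
  telescope : ∀ a b c → a ℚ.- c ≡ (a ℚ.- b) ℚ.+ (b ℚ.- c)
  telescope = solve 3 (λ a b c → a :- c := (a :- b) :+ (b :- c)) ≡.refl

+ᴿ-cong : ∀ {x y u v} → x ≈ᴿ y → u ≈ᴿ v → x +ᴿ u ≈ᴿ y +ᴿ v
+ᴿ-cong {x} {y} {u} {v} p q ε ε>0 = eventually-∩
  (λ n a b → triangle-split (seq (x +ᴿ u) n) (seq (y +ᴿ v) n) a b
               (rearrange (seq x n) (seq u n) (seq y n) (seq v n)))
  (p _ (half ε>0)) (q _ (half ε>0))
  where
  open +-*-Solver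
  rearrange : ∀ a b c d → (a ℚ.+ b) ℚ.- (c ℚ.+ d) ≡ (a ℚ.- c) ℚ.+ (b ℚ.- d)
  rearrange = solve 4 (λ a b c d → (a :+ b) :- (c :+ d) := (a :- c) :+ (b :- d)) ≡.refl

scale-cong : ∀ q {x y} → x ≈ᴿ y → fromℚ q *ᴿ x ≈ᴿ fromℚ q *ᴿ y
scale-cong q {x} {y} p ε ε>0 =
  let (N , r) = p (ℚ.1/ B ℚ.* ε) δ>0
  in N , λ n n≥ → bound (seq x n) (seq y n) (r n n≥)
  where
  B : ℚ
  -- Adding 1 keeps the bound positive, hence invertible, even when `q` is 0.
  B = 1ℚ ℚ.+ ℚ.∣ q ∣
  instance
    B-pos : ℚ.Positive B
    B-pos = ℚ.positive (ℚₚ.+-mono-<-≤ (ℚₚ.positive⁻¹ 1ℚ) (ℚₚ.0≤∣p∣ q))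
    B≢0 : ℚ.NonZero B
    B≢0 = ℚₚ.pos⇒nonZero B
    1/B-pos : ℚ.Positive (ℚ.1/ B)
    1/B-pos = ℚₚ.1/pos⇒pos B
  δ>0 : 0ℚ ℚ.< ℚ.1/ B ℚ.* ε
  δ>0 = ≡.subst (ℚ._< ℚ.1/ B ℚ.* ε) (ℚₚ.*-zeroʳ (ℚ.1/ B)) (ℚₚ.*-monoʳ-<-pos (ℚ.1/ B) ε>0)
  open ℚₚ.≤-Reasoning
  bound : ∀ a b → ℚ.∣ a ℚ.- b ∣ ℚ.< ℚ.1/ B ℚ.* ε → ℚ.∣ q ℚ.* a ℚ.- q ℚ.* b ∣ ℚ.< ε
  bound a b small = begin-strict
    ℚ.∣ q ℚ.* a ℚ.- q ℚ.* b ∣      ≡⟨ ≡.cong ℚ.∣_∣ (factor q a b) ⟩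
    ℚ.∣ q ℚ.* (a ℚ.- b) ∣          ≡⟨ ℚₚ.∣p*q∣≡∣p∣*∣q∣ q (a ℚ.- b) ⟩
    ℚ.∣ q ∣ ℚ.* ℚ.∣ a ℚ.- b ∣      ≤⟨ ℚₚ.*-monoʳ-≤-nonNeg ℚ.∣ a ℚ.- b ∣ {{ℚₚ.∣-∣-nonNeg (a ℚ.- b)}} q≤B ⟩
    B ℚ.* ℚ.∣ a ℚ.- b ∣            <⟨ ℚₚ.*-monoʳ-<-pos B small ⟩
    B ℚ.* (ℚ.1/ B ℚ.* ε)           ≡⟨ ℚₚ.*-assoc B (ℚ.1/ B) ε ⟨
    (B ℚ.* ℚ.1/ B) ℚ.* ε           ≡⟨ ≡.cong (ℚ._* ε) (ℚₚ.*-inverseʳ B) ⟩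
    1ℚ ℚ.* ε                       ≡⟨ ℚₚ.*-identityˡ ε ⟩
    ε                              ∎
    where
    factor : ∀ q a b → q ℚ.* a ℚ.- q ℚ.* b ≡ q ℚ.* (a ℚ.- b)
    factor = solve 3 (λ q a b → q :* a :- q :* b := q :* (a :- b)) ≡.refl
      where open +-*-Solver
    q≤B : ℚ.∣ q ∣ ℚ.≤ B
    q≤B = ≡.subst (ℚ._≤ B) (ℚₚ.+-identityˡ ℚ.∣ q ∣)
            (ℚₚ.+-monoˡ-≤ ℚ.∣ q ∣ (ℚₚ.<⇒≤ (ℚₚ.positive⁻¹ 1ℚ)))

≈ᴿ-setoid : Setoid _ _
≈ᴿ-setoid = record
  { Carrier = ℝ ; _≈_ = _≈ᴿ_
  ; isEquivalence = record
    { refl  = λ {x} → ≡⇒≈ᴿ {x} {x} (λ _ → ≡.refl)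
    ; sym   = λ {x} {y} → ≈ᴿ-sym {x} {y}
    ; trans = λ {x} {y} {z} → ≈ᴿ-trans {x} {y} {z} } }

x≈x+x⇒x≈0 : ∀ x → x ≈ᴿ x +ᴿ x → x ≈ᴿ 0ᴿ
x≈x+x⇒x≈0 x p ε ε>0 with p ε ε>0
... | N , q = N , λ n n≥ → ≡.subst (ℚ._< ε)
  (≡.trans (≡.sym (ℚₚ.∣-p∣≡∣p∣ (seq x n ℚ.- (seq x n ℚ.+ seq x n)))) (≡.cong ℚ.∣_∣ (cancel (seq x n))))
  (q n n≥)
  where
  open +-*-Solver
  cancel : ∀ a → ℚ.- (a ℚ.- (a ℚ.+ a)) ≡ a ℚ.- 0ℚ
  cancel = solve 1 (λ a → :- (a :- (a :+ a)) := a :- con 0ℚ) ≡.refl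

scale-0 : ∀ q → fromℚ q *ᴿ 0ᴿ ≈ᴿ 0ᴿ
scale-0 q = ≡⇒≈ᴿ {fromℚ q *ᴿ 0ᴿ} {0ᴿ} λ _ → ℚₚ.*-zeroʳ q

natural : ℕ → ℚ
natural n = (+ n) ℚ./ 1

-- Fractions in `ℚ` are stored in lowest terms, so the identity is checked in the unnormalised
-- rationals, where equality is cross-multiplication.
natural-suc : ∀ n → natural (suc n) ≡ 1ℚ ℚ.+ natural n
natural-suc n = ℚₚ.toℚᵘ-injective (begin
  ℚ.toℚᵘ (natural (suc n))        ≈⟨ ℚₚ.toℚᵘ-fromℚᵘ ((+ suc n) ℚᵘ./ 1) ⟩
  (+ suc n) ℚᵘ./ 1                ≈⟨ ℚᵘ.*≡* (≡.cong (λ k → (+ 1 ℤ.+ k) ℤ.* + 1) (≡.sym (ℤₚ.*-identityʳ (+ n)))) ⟩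
  ℚᵘ.1ℚᵘ ℚᵘ.+ (+ n) ℚᵘ./ 1        ≈⟨ ℚᵘₚ.+-congʳ ℚᵘ.1ℚᵘ (ℚₚ.toℚᵘ-fromℚᵘ ((+ n) ℚᵘ./ 1)) ⟨
  ℚᵘ.1ℚᵘ ℚᵘ.+ ℚ.toℚᵘ (natural n)  ≈⟨ ℚₚ.toℚᵘ-homo-+ 1ℚ (natural n) ⟨
  ℚ.toℚᵘ (1ℚ ℚ.+ natural n)       ∎)
  where open ℚᵘₚ.≃-Reasoning

/-*-natural : ∀ a m .{{_ : NonZero m}} → ((+ a) ℚ./ m) ℚ.* natural m ≡ natural a
/-*-natural a m@(suc _) = ℚₚ.toℚᵘ-injective (begin
  ℚ.toℚᵘ (((+ a) ℚ./ m) ℚ.* natural m)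
    ≈⟨ ℚₚ.toℚᵘ-homo-* ((+ a) ℚ./ m) (natural m) ⟩
  ℚ.toℚᵘ ((+ a) ℚ./ m) ℚᵘ.* ℚ.toℚᵘ (natural m)
    ≈⟨ ℚᵘₚ.*-cong (ℚₚ.toℚᵘ-fromℚᵘ ((+ a) ℚᵘ./ m)) (ℚₚ.toℚᵘ-fromℚᵘ ((+ m) ℚᵘ./ 1)) ⟩
  ((+ a) ℚᵘ./ m) ℚᵘ.* ((+ m) ℚᵘ./ 1)
    ≈⟨ ℚᵘ.*≡* (ℤₚ.*-assoc (+ a) (+ m) (+ 1)) ⟩
  (+ a) ℚᵘ./ 1
    ≈⟨ ℚₚ.toℚᵘ-fromℚᵘ ((+ a) ℚᵘ./ 1) ⟨
  ℚ.toℚᵘ (natural a)  ∎)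
  where open ℚᵘₚ.≃-Reasoning

¼ : ℚ
¼ = ½ ℚ.* ½

-- The way down from 1 to 0 through `y`, `l` and `x` consists of four steps, each at most ¼. The
-- first and the last are strictly shorter, so together they cannot reach from 1 to 0.
no-common-limit : ∀ {x y l} → x ≈ᴿ 0ᴿ → y ≈ᴿ 1ᴿ → ∣ x - l ∣< ¼ → ∣ y - l ∣< ¼ → ⊥
no-common-limit {x} {y} {l} x≈0 y≈1 (_ , δ , δ>0 , l<x) ((η , η>0 , y<l) , _) = absurd
  where
  open ℚₚ.≤-Reasoning
  p≤∣p∣ : ∀ p → p ℚ.≤ ℚ.∣ p ∣
  p≤∣p∣ p with ℚₚ.≤-total 0ℚ p
  ... | inj₁ 0≤p = ℚₚ.≤-reflexive (≡.sym (ℚₚ.0≤p⇒∣p∣≡p 0≤p))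
  ... | inj₂ p≤0 = ℚₚ.≤-trans p≤0 (ℚₚ.0≤∣p∣ p)
  weaken : ∀ {a b e} → 0ℚ ℚ.< e → a ℚ.+ e ℚ.≤ b → a ℚ.≤ b
  weaken {a} {b} {e} e>0 a+e≤b = ℚₚ.≤-trans
    (≡.subst (ℚ._≤ a ℚ.+ e) (ℚₚ.+-identityʳ a) (ℚₚ.+-monoʳ-≤ a (ℚₚ.<⇒≤ e>0))) a+e≤b
  contradictory : ∀ a b c → b ℚ.≤ a ℚ.+ ¼ → c ℚ.≤ b ℚ.+ ¼ →
                  ℚ.∣ a ℚ.- 0ℚ ∣ ℚ.< ¼ → ℚ.∣ c ℚ.- 1ℚ ∣ ℚ.< ¼ → ⊥
  contradictory a b c b≤ c≤ a< c< = ℚₚ.<-irrefl ≡.refl (begin-strict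
    1ℚ                            ≡⟨ regroup c ⟩
    (1ℚ ℚ.- c) ℚ.+ c              ≤⟨ ℚₚ.+-mono-≤ (p≤∣p∣ (1ℚ ℚ.- c)) c≤ ⟩
    ℚ.∣ 1ℚ ℚ.- c ∣ ℚ.+ (b ℚ.+ ¼)  ≡⟨ ≡.cong (ℚ._+ (b ℚ.+ ¼)) (∣p-q∣≡∣q-p∣ 1ℚ c) ⟩
    ℚ.∣ c ℚ.- 1ℚ ∣ ℚ.+ (b ℚ.+ ¼)  <⟨ ℚₚ.+-mono-<-≤ c< (ℚₚ.+-monoˡ-≤ ¼ b≤) ⟩
    ¼ ℚ.+ ((a ℚ.+ ¼) ℚ.+ ¼)       ≡⟨ ≡.cong (λ t → ¼ ℚ.+ ((t ℚ.+ ¼) ℚ.+ ¼)) (minus-0 a) ⟩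
    ¼ ℚ.+ (((a ℚ.- 0ℚ) ℚ.+ ¼) ℚ.+ ¼)
      <⟨ ℚₚ.+-monoʳ-< ¼ (ℚₚ.+-monoˡ-< ¼ (ℚₚ.+-monoˡ-< ¼ (ℚₚ.≤-<-trans (p≤∣p∣ (a ℚ.- 0ℚ)) a<))) ⟩
    1ℚ                            ∎)
    where
    open +-*-Solver
    regroup : ∀ c → 1ℚ ≡ (1ℚ ℚ.- c) ℚ.+ c
    regroup = solve 1 (λ c → con 1ℚ := (con 1ℚ :- c) :+ c) ≡.refl
    minus-0 : ∀ a → a ≡ a ℚ.- 0ℚ
    minus-0 = solve 1 (λ a → a := a :- con 0ℚ) ≡.refl
  absurd : ⊥
  absurd =
    let (N , p) = eventually-∩ {R = λ _ → ⊥} (λ { n (l< , y<) (a< , c<) →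
                      contradictory (seq x n) (seq l n) (seq y n) (weaken δ>0 l<) (weaken η>0 y<) a< c< })
                    (eventually-∩ (λ _ → _,_) l<x y<l)
                    (eventually-∩ (λ _ → _,_) (x≈0 ¼ (ℚₚ.positive⁻¹ ¼)) (y≈1 ¼ (ℚₚ.positive⁻¹ ¼)))
    in p N ℕₚ.≤-refl

-- Countability of global fields

field-cancelˡ : ∀ {F : Ring₀} → RingDefinitions.IsField F → let open CommutativeRing F in
  ∀ {a x y} → ¬ (a ≈ 0#) → a * x ≈ a * y → x ≈ y
field-cancelˡ {F} isField {a} {x} {y} a≉0 ax≈ay = begin
  x                ≈⟨ undo x ⟨
  a⁻¹ * (a * x)    ≈⟨ *-congˡ ax≈ay ⟩
  a⁻¹ * (a * y)    ≈⟨ undo y ⟩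
  y                ∎
  where
  open CommutativeRing F
  open RingDefinitions.IsField isField
  open SetoidReasoning setoid
  a⁻¹ = proj₁ (inverses a a≉0)
  undo : ∀ z → a⁻¹ * (a * z) ≈ z
  undo z = begin
    a⁻¹ * (a * z)    ≈⟨ *-assoc a⁻¹ a z ⟨
    (a⁻¹ * a) * z    ≈⟨ *-congʳ (trans (*-comm a⁻¹ a) (proj₂ (inverses a a≉0))) ⟩
    1# * z           ≈⟨ *-identityˡ z ⟩
    z                ∎

-- Binary trees absorb pairs and lists without any arithmetic, which makes them
-- a convenient countable set of codes.
data Code : Set where
  leaf : Code
  node : Code → Code → Code

node-injective : ∀ {a b c d} → node a b ≡ node c d → a ≡ c × b ≡ d
node-injective ≡.refl = ≡.refl , ≡.refl

-- Leaves count as height 1, so that no code has height 0 and the enumeration below can start from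
-- the empty list.
height : Code → ℕ
height leaf       = 1
height (node a b) = suc (height a ℕ.⊔ height b)

codesUpTo : ℕ → List Code
codesUpTo zero    = []
codesUpTo (suc n) = leaf ∷ cartesianProductWith node (codesUpTo n) (codesUpTo n)

∈-codesUpTo : ∀ c {n} → height c ℕ.≤ n → c ∈ codesUpTo n
∈-codesUpTo leaf       (s≤s _) = here ≡.refl
∈-codesUpTo (node a b) (s≤s h) = there (∈-cartesianProductWith⁺ node
  (∈-codesUpTo a (ℕₚ.m⊔n≤o⇒m≤o (height a) (height b) h))
  (∈-codesUpTo b (ℕₚ.m⊔n≤o⇒n≤o (height a) (height b) h)))

-- Countability for a setoid. The code need not respect `≈`; only equal codes must come from equal
-- elements. Thus a code may depend on an arbitrary choice of coordinates or of a fraction.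
record Coding {A : Set} (_≈_ : Rel A 0ℓ) : Set where
  field
    code           : A → Code
    code-injective : ∀ {x y} → code x ≡ code y → x ≈ y

open Coding

ℕ-coding : Coding {ℕ} _≡_
ℕ-coding = record { code = c ; code-injective = inj _ _ }
  where
  c : ℕ → Code
  c zero    = leaf
  c (suc n) = node leaf (c n)
  inj : ∀ m n → c m ≡ c n → m ≡ n
  inj zero    zero    _ = ≡.refl
  inj (suc m) (suc n) p = ≡.cong suc (inj m n (proj₂ (node-injective p)))

ℤ-coding : Coding {ℤ} _≡_
ℤ-coding = record { code = c ; code-injective = inj _ _ }
  where
  c : ℤ → Code
  c (+ n)    = node leaf (code ℕ-coding n)
  c -[1+ n ] = node (node leaf leaf) (code ℕ-coding n)
  inj : ∀ m n → c m ≡ c n → m ≡ n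
  inj (+ m)    (+ n)    p = ≡.cong +_ (code-injective ℕ-coding (proj₂ (node-injective p)))
  inj -[1+ m ] -[1+ n ] p = ≡.cong -[1+_] (code-injective ℕ-coding (proj₂ (node-injective p)))

-- The coprimality proof stored in a rational is irrelevant, so numerator and denominator determine
-- it.
ℚ-coding : Coding {ℚ} _≡_
ℚ-coding = record { code = c ; code-injective = inj _ _ }
  where
  c : ℚ → Code
  c (mkℚ n d _) = node (code ℤ-coding n) (code ℕ-coding d)
  inj : ∀ p q → c p ≡ c q → p ≡ q
  inj (mkℚ _ _ _) (mkℚ _ _ _) e
    with code-injective ℤ-coding (proj₁ (node-injective e)) | code-injective ℕ-coding (proj₂ (node-injective e))
  ... | ≡.refl | ≡.refl = ≡.refl

module _ {A : Set} {_≈_ : Rel A 0ℓ} (C : Coding _≈_) where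

  listCode : List A → Code
  listCode []       = leaf
  listCode (x ∷ xs) = node (code C x) (listCode xs)

  listCode-injective : ∀ xs ys → listCode xs ≡ listCode ys → Pointwise _≈_ xs ys
  listCode-injective []       []       _ = []
  listCode-injective (x ∷ xs) (y ∷ ys) p =
    code-injective C (proj₁ (node-injective p)) ∷ listCode-injective xs ys (proj₂ (node-injective p))

  vectorCode : ∀ {n} → Vector A n → Code
  vectorCode {zero}  _ = leaf
  vectorCode {suc n} v = node (code C (v zero)) (vectorCode (v ∘ suc))

  vectorCode-injective : ∀ {n} (v w : Vector A n) → vectorCode v ≡ vectorCode w → ∀ i → v i ≈ w i
  vectorCode-injective v w p zero    = code-injective C (proj₁ (node-injective p))
  vectorCode-injective v w p (suc i) =
    vectorCode-injective (v ∘ suc) (w ∘ suc) (proj₂ (node-injective p)) i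

finite-coding : ∀ {A n} → HasCardinality A U n → Coding (Setoid._≈_ A)
finite-coding {A} h = record
  { code           = λ x → code ℕ-coding (toℕ (index x))
  ; code-injective = λ {x} {y} p → trans (sym (proj₂ (surjective {x} _)))
      (trans (reflexive (≡.cong e (Finₚ.toℕ-injective (code-injective ℕ-coding p)))) (proj₂ (surjective {y} _)))
  }
  where
  open Setoid A
  open HasCardinality h using (e; surjective)
  index : Carrier → Fin _
  index x = proj₁ (surjective {x} _)

-- Any coordinates with respect to a spanning family recover the element, so the family need not be
-- a basis and the coordinates need not be unique.
extension-coding : ∀ {K L} → FiniteExtension K L → Coding (CommutativeRing._≈_ K) → Coding (CommutativeRing._≈_ L)
extension-coding {K} {L} E C = record
  { code           = λ x → vectorCode C (proj₁ (spanning x))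
  ; code-injective = λ {x} {y} p → trans (proj₂ (spanning x)) (trans
      (sum-cong-≋ λ i → *-congʳ (Hom.⟦⟧-cong (vectorCode-injective C _ _ p i)))
      (sym (proj₂ (spanning y))))
  }
  where
  open FiniteExtension E
  open CommutativeRing L
  open MonoidSum +-monoid using (sum-cong-≋)
  module Hom = IsHom K L isHom

-- Equal codes give numerators and denominators with the same coefficients, hence the same values at
-- `t`. The value of the denominator is non-zero because `t` is transcendental, so it can be
-- cancelled.
rationalFunction-coding : ∀ {k K} → IsRationalFunctionField k K →
  Coding (CommutativeRing._≈_ k) → Coding (CommutativeRing._≈_ K)
rationalFunction-coding {k} {K} R C = record
  { code           = λ x → let (p , q , _) = fractions x in node (listCode C p) (listCode C q)
  ; code-injective = λ {x} {y} e → inj x y (fractions x) (fractions y) e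
  }
  where
  open IsRationalFunctionField R
  module k = CommutativeRing k
  open CommutativeRing K
  module Hom = IsHom k K isHom
  open SetoidReasoning setoid
  ev : List k.Carrier → Carrier
  ev p = RingDefinitions.eval K (map φ p) t
  ev-cong : ∀ {p q} → Pointwise k._≈_ p q → ev p ≈ ev q
  ev-cong []      = refl
  ev-cong (a ∷ p) = +-cong (Hom.⟦⟧-cong a) (*-congˡ (ev-cong p))
  open RingDefinitions k using (_≈ₚ_)
  Fraction : Carrier → Set
  Fraction x = ∃[ p ] ∃[ q ] ¬ (q ≈ₚ []) × (ev q * x ≈ ev p)
  inj : ∀ x y (f : Fraction x) (g : Fraction y) →
        node (listCode C (proj₁ f)) (listCode C (proj₁ (proj₂ f))) ≡
        node (listCode C (proj₁ g)) (listCode C (proj₁ (proj₂ g))) → x ≈ y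
  inj x y (p , q , q≉0 , qx≈p) (p′ , q′ , _ , q′y≈p′) e =
    field-cancelˡ {K} isField (λ z → q≉0 (transcendental q z)) (begin
    ev q * x      ≈⟨ qx≈p ⟩
    ev p          ≈⟨ ev-cong (listCode-injective C p p′ (proj₁ (node-injective e))) ⟩
    ev p′         ≈⟨ q′y≈p′ ⟨
    ev q′ * y     ≈⟨ *-congʳ (ev-cong (listCode-injective C q q′ (proj₂ (node-injective e)))) ⟨
    ev q * y      ∎)

globalField-coding : ∀ {F} → IsGlobalField F → Coding (CommutativeRing._≈_ F)
globalField-coding G with IsGlobalField.finite G
... | inj₁ E                     = extension-coding E ℚ-coding
... | inj₂ (k , K , (_ , _ , finite) , R , E) =
  extension-coding E (rationalFunction-coding R (finite-coding finite))

embedding-coding : ∀ {D F ι} → IsEmbedding D F ι →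
  Coding (CommutativeRing._≈_ F) → Coding (CommutativeRing._≈_ D)
embedding-coding {D} {F} {ι} E C = record
  { code           = code C ∘ ι
  ; code-injective = λ p → IsEmbedding.injective {R = D} {R′ = F} E (code-injective C p)
  }

-- Compactness

module _ (D : Ring₀) where
  private
    module D = CommutativeRing D
    module Q (n : NonzeroIdeal D) = Setoid (quotient D n)

  _≼_ : NonzeroIdeal D → NonzeroIdeal D → Set
  m ≼ n = ∀ x → member (ideal m) x → member (ideal n) x

  -- Representatives may repeat: the compactness argument only needs finitely many that meet every
  -- class.
  FiniteQuotients : Set₁
  FiniteQuotients = ∀ n → ∃[ N ] Σ (Fin N → D.Carrier) λ r → ∀ x → ∃[ i ] Congruent D n (r i) x

  record CofinalChain : Set₁ where
    field
      chain      : ℕ → NonzeroIdeal D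
      descending : ∀ j → chain (suc j) ≼ chain j
      cofinal    : ∀ n → ∃[ j ] chain j ≼ n

  -- By compatibility the residue of each element at `n` is congruent modulo `n` to its residue at
  -- `k`, where the congruence is known.
  coarsen : ∀ {n k} → k ≼ n → (x y : Profinite D) →
            Congruent D k (at x k) (at y k) → Congruent D n (at x n) (at y n)
  coarsen {n} {k} k≼n x y p = Q.trans n {_} {at x k} {at y n}
    (Q.sym n {at x k} (compatible x n k λ {a} → k≼n a))
    (Q.trans n {_} {at y k} (k≼n _ p) (compatible y n k λ {a} → k≼n a))

  IsSaturated : ∀ {m} → NonzeroIdeal D → Subset D m → Set₁
  IsSaturated n V = ∀ x y → _≡_[mod_] D x y n → V x → V y

  module _ (em : ∀ {ℓ} → ExcludedMiddle ℓ) (finite : FiniteQuotients) (c : CofinalChain) where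
    open CofinalChain c

    descending-≤ : ∀ {i j} → i ℕ.≤′ j → chain j ≼ chain i
    descending-≤ ℕ.≤′-refl       x p = p
    descending-≤ (ℕ.≤′-step i≤j) x p = descending-≤ i≤j x (descending _ x p)

    module _ {m} (V : Subset D m) (n₀ : NonzeroIdeal D) (saturated : IsSaturated n₀ V)
             {I : Set₁} (C : I → Subset D m) (C-open : ∀ i → IsOpen D (C i))
             (covers : ∀ x → V x → ∃[ i ] C i x) where

      Covered : ∀ {a} → Pred (Power D m) a → Set _
      Covered A = ∃[ is ] ∀ x → A x → Any (λ i → C i x) is

      covered-⋃ : ∀ {a L} (B : Fin L → Pred (Power D m) a) → (∀ l → Covered (B l)) →
                  Covered (λ x → ∃[ l ] B l x)
      covered-⋃ {L = zero}  B cov = [] , λ { _ (() , _) }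
      covered-⋃ {L = suc L} B cov with cov zero | covered-⋃ (B ∘ suc) (cov ∘ suc)
      ... | is , p | js , q = is ++ js , λ
        { x (zero  , b) → ++⁺ˡ (p x b)
        ; x (suc l , b) → ++⁺ʳ is (q x (l , b)) }

      Ball : NonzeroIdeal D → Vector D.Carrier m → Pred (Power D m) 0ℓ
      Ball n z x = ∀ i → Congruent D n (at (x i) n) (z i)

      -- The branching step of König's lemma. The finitely many balls of level `n` exhaust the
      -- space, so if each met `A` in a covered set, the union of their finite subcovers would cover
      -- `A`.
      uncovered-ball : ∀ {a} (A : Pred (Power D m) a) n → ¬ Covered A → ∃[ z ] ¬ Covered (A ∩ Ball n z)
      uncovered-ball A n ¬cov with finite n
      ... | N , r , r-onto with em {P = ∃[ z ] ¬ Covered (A ∩ Ball n z)}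
      ...   | yes found = found
      ...   | no  none  = contradiction cov ¬cov
        where
        rep : Fin (N ℕ.^ m) → Vector D.Carrier m
        rep l i = r (finToFun l i)
        each : ∀ l → Covered (A ∩ Ball n (rep l))
        each l with em {P = Covered (A ∩ Ball n (rep l))}
        ... | yes p = p
        ... | no ¬p = contradiction (rep l , ¬p) none
        cov : Covered A
        cov with covered-⋃ (λ l → A ∩ Ball n (rep l)) each
        ... | is , p = is , λ x Ax →
          let f : Fin m → Fin N
              f i = proj₁ (r-onto (at (x i) n))
          in p x (funToFin f , Ax , λ i → Q.sym n (≡.subst (λ j → Congruent D n (r j) (at (x i) n))
               (≡.sym (Finₚ.finToFun-funToFin f i)) (proj₂ (r-onto (at (x i) n)))))

      -- The empty list of open sets already covers the empty set.
      uncovered⇒nonempty : ∀ {a} {A : Pred (Power D m) a} → ¬ Covered A → ∃ A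
      uncovered⇒nonempty {A = A} ¬cov with em {P = ∃ A}
      ... | yes p    = p
      ... | no none  = contradiction ([] , λ x Ax → contradiction (x , Ax) none) ¬cov

      covered-⊆ : ∀ {a b} {A : Pred (Power D m) a} {B : Pred (Power D m) b} →
                  A ⊆ B → Covered B → Covered A
      covered-⊆ A⊆B (is , p) = is , λ x Ax → p x (A⊆B Ax)

      module _ (¬cov : ¬ Covered V) where

        -- next keeps the previous ball in the intersection, so that consecutive
        -- centres are congruent.
        centre : ∀ j → ∃[ z ] ¬ Covered (V ∩ Ball (chain j) z)
        next : ∀ j → ∃[ z ] ¬ Covered ((V ∩ Ball (chain j) (proj₁ (centre j))) ∩ Ball (chain (suc j)) z)
        centre zero    = uncovered-ball V (chain 0) ¬cov
        centre (suc j) = proj₁ (next j) , λ cov → proj₂ (next j) (covered-⊆ (λ { ((v , _) , b) → v , b }) cov)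
        next j = uncovered-ball _ (chain (suc j)) (proj₂ (centre j))

        z : ℕ → Vector D.Carrier m
        z j = proj₁ (centre j)

        -- The intersection of the two consecutive balls is uncovered, hence has a point, and this
        -- point links their centres modulo the coarser ideal.
        z-step : ∀ j i → Congruent D (chain j) (z j i) (z (suc j) i)
        z-step j i with uncovered⇒nonempty (proj₂ (next j))
        ... | x , (_ , p) , q =
          Q.trans (chain j) {_} {at (x i) (chain j)} (Q.sym (chain j) {at (x i) (chain j)} (p i))
            (coarsen (descending j) (x i) (embed D (z (suc j) i)) (q i))

        z-≤ : ∀ {j k} → j ℕ.≤′ k → ∀ i → Congruent D (chain j) (z j i) (z k i)
        z-≤ {j} ℕ.≤′-refl             i = Q.refl (chain j)
        z-≤ {j} (ℕ.≤′-step {k} j≤k) i =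
          Q.trans (chain j) {_} {z k i} (z-≤ j≤k i) (descending-≤ j≤k _ (z-step k i))

        depth : NonzeroIdeal D → ℕ
        depth n = proj₁ (cofinal n)

        -- The branch found so far gives residues only along the chain. At an arbitrary `n` the
        -- residue is the centre at a depth where the chain lies inside `n`; two such choices are
        -- compared through the centre at the larger depth.
        limit : Power D m
        limit i = mkProfinite (λ n → z (depth n) i) λ n k k≼n →
          let j = depth n ℕ.⊔ depth k
              below-k = ℕₚ.≤⇒≤′ (ℕₚ.m≤n⊔m (depth n) (depth k))
              below-n = ℕₚ.≤⇒≤′ (ℕₚ.m≤m⊔n (depth n) (depth k))
          in Q.trans n {_} {z j i} (k≼n (proj₂ (cofinal k) _ (z-≤ below-k i)))
               (Q.sym n {z (depth n) i} (proj₂ (cofinal n) _ (z-≤ below-n i)))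

        near-limit : ∀ n x → Ball (chain (depth n)) (z (depth n)) x → _≡_[mod_] D x limit n
        near-limit n x b i = coarsen (proj₂ (cofinal n)) (x i) (embed D (z (depth n) i)) (b i)

        -- If the limit lies outside `V`, saturation makes a whole ball of the branch miss `V`, and
        -- the empty list covers that part of `V`. If it lies in `V`, a single member of the cover
        -- contains a whole ball of the branch. Both contradict that no ball of the branch meets `V`
        -- in a covered set.
        limit-absurd : Dec (V limit) → Covered V
        limit-absurd (no ∉V) = contradiction
          ([] , λ x (v , b) → contradiction (saturated x limit (near-limit n₀ x b) v) ∉V)
          (proj₂ (centre (depth n₀)))
        limit-absurd (yes ∈V) with covers limit ∈V
        ... | i , ∈C with C-open i limit ∈C
        ...   | n , open-at = contradiction
          (i ∷ [] , λ x (v , b) → here (open-at x λ j → Q.sym n {at (x j) n} (near-limit n x b j)))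
          (proj₂ (centre (depth n)))

      covered : Covered V
      covered with em {P = Covered V}
      ... | yes p = p
      ... | no ¬p = limit-absurd ¬p em

    saturated⇒compactOpen : ∀ {m} (V : Subset D m) n → IsSaturated n V → CompactOpen D m
    saturated⇒compactOpen V n saturated = record
      { set       = V
      ; isOpen    = λ x Vx → n , λ y x≡y → saturated x y x≡y Vx
      ; isCompact = λ C C-open covers → covered V n saturated C C-open covers
      }

-- Ideals

NoZeroDivisors : Pred Ring₀ 0ℓ
NoZeroDivisors D = ∀ {x y} → ¬ (x ≈ 0#) → ¬ (y ≈ 0#) → ¬ (x * y ≈ 0#)
  where open CommutativeRing D

field⇒noZeroDivisors : ∀ {F} → RingDefinitions.IsField F → NoZeroDivisors F
field⇒noZeroDivisors {F} isField {x} x≉0 y≉0 xy≈0 =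
  y≉0 (field-cancelˡ {F} isField x≉0 (trans xy≈0 (sym (zeroʳ x))))
  where open CommutativeRing F

subring⇒noZeroDivisors : ∀ {D F ι} → IsEmbedding D F ι → NoZeroDivisors F → NoZeroDivisors D
subring⇒noZeroDivisors {D} {F} {ι} E nzd x≉0 y≉0 xy≈0 =
  nzd (ι-≉0 x≉0) (ι-≉0 y≉0)
    (F.trans (F.sym (M.*-homo _ _)) (F.trans (M.⟦⟧-cong xy≈0) M.0#-homo))
  where
  module D = CommutativeRing D
  module F = CommutativeRing F
  module M = IsEmbedding D F E
  ι-≉0 : ∀ {x} → ¬ (x D.≈ D.0#) → ¬ (ι x F.≈ F.0#)
  ι-≉0 x≉0 ιx≈0 = x≉0 (M.injective (F.trans ιx≈0 (F.sym M.0#-homo)))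

module _ (D : Ring₀) where
  open CommutativeRing D hiding (zero)
  open RingDefinitions D using (sum; product; _∣_)
  open RawMagmaDefinitions *-rawMagma using (_,_)
  open Divisibility semiring using (∣ʳ-trans; ∣ʳ-refl; ∣ʳ-respʳ-≈; ∣ʳ-respˡ-≈; _∣0; x∣ʳyx)
  open SemiringSum semiring using (*-distribˡ-sum; sum-cong-≋)
  open CommutativeSemigroupProperties *-commutativeSemigroup using (x∙yz≈y∙xz)

  InProduct-∙ : (I J : Ideal D) → ∀ {a b} → member I a → member J b → InProduct D I J (a * b)
  InProduct-∙ I J {a} {b} a∈I b∈J =
    1 , (λ _ → a) , (λ _ → b) , (λ _ → a∈I) , (λ _ → b∈J) , sym (+-identityʳ (a * b))

  InProduct-⊆ : (I J K : Ideal D) → (∀ {a b} → member I a → member J b → member K (a * b)) →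
                ∀ {x} → InProduct D I J x → member K x
  InProduct-⊆ I J K ab∈K (n , a , b , a∈I , b∈J , x≈) = resp K (sym x≈) (sum∈K n a b a∈I b∈J)
    where
    sum∈K : ∀ n (a b : Vector Carrier n) → (∀ i → member I (a i)) → (∀ i → member J (b i)) →
            member K (sum (λ i → a i * b i))
    sum∈K zero    a b a∈I b∈J = 0-closed K
    sum∈K (suc n) a b a∈I b∈J = +-closed K (ab∈K (a∈I zero) (b∈J zero))
      (sum∈K n (a ∘ suc) (b ∘ suc) (a∈I ∘ suc) (b∈J ∘ suc))

  productIdeal : Ideal D → Ideal D → Ideal D
  productIdeal I J = record
    { member   = InProduct D I J
    ; resp     = respects
    ; 0-closed = 0 , (λ ()) , (λ ()) , (λ ()) , (λ ()) , refl
    ; +-closed = λ { (n , a , b , a∈I , b∈J , x≈) q →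
        respects (+-congʳ (sym x≈)) (sum-+ n a b a∈I b∈J q) }
    ; *-closed = λ { r {x} (n , a , b , a∈I , b∈J , x≈) →
        n , (λ i → r * a i) , b , (λ i → *-closed I r (a∈I i)) , b∈J ,
        trans (*-congˡ x≈) (trans (*-distribˡ-sum r (λ i → a i * b i))
          (sum-cong-≋ {n} λ i → sym (*-assoc r (a i) (b i)))) }
    }
    where
    respects : ∀ {x y} → x ≈ y → InProduct D I J x → InProduct D I J y
    respects x≈y (n , a , b , a∈I , b∈J , x≈) = n , a , b , a∈I , b∈J , trans (sym x≈y) x≈
    cons : ∀ {a b y} → member I a → member J b → InProduct D I J y → InProduct D I J (a * b + y)
    cons a∈I b∈J (n , as , bs , as∈I , bs∈J , y≈) =
      suc n , _ ∷ᵛ as , _ ∷ᵛ bs ,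
      (λ { zero → a∈I ; (suc i) → as∈I i }) , (λ { zero → b∈J ; (suc i) → bs∈J i }) , +-congˡ y≈
    sum-+ : ∀ n (a b : Vector Carrier n) → (∀ i → member I (a i)) → (∀ i → member J (b i)) →
            ∀ {y} → InProduct D I J y → InProduct D I J (sum (λ i → a i * b i) + y)
    sum-+ zero    a b a∈I b∈J q = respects (sym (+-identityˡ _)) q
    sum-+ (suc n) a b a∈I b∈J q = respects (sym (+-assoc _ _ _))
      (cons (a∈I zero) (b∈J zero) (sum-+ n (a ∘ suc) (b ∘ suc) (a∈I ∘ suc) (b∈J ∘ suc) q))

  principalIdeal : Carrier → Ideal D
  principalIdeal g = record
    { member   = g ∣_
    ; resp     = ∣ʳ-respʳ-≈
    ; 0-closed = g ∣0
    ; +-closed = λ { (q , qg≈x) (r , rg≈y) → q + r , trans (distribʳ g q r) (+-cong qg≈x rg≈y) }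
    ; *-closed = λ r g∣x → ∣ʳ-trans g∣x (x∣ʳyx _ r)
    }

  principal : ∀ g → ¬ (g ≈ 0#) → NonzeroIdeal D
  principal g g≉0 = record { ideal = principalIdeal g ; nonzero = g , ∣ʳ-refl , g≉0 }

  scaledIdeal : Ideal D → Carrier → Ideal D
  scaledIdeal I p = record
    { member   = λ x → ∃[ a ] member I a × x ≈ a * p
    ; resp     = λ { x≈y (a , a∈I , x≈ap) → a , a∈I , trans (sym x≈y) x≈ap }
    ; 0-closed = 0# , 0-closed I , sym (zeroˡ p)
    ; +-closed = λ { (a , a∈I , x≈ap) (b , b∈I , y≈bp) →
        a + b , +-closed I a∈I b∈I , trans (+-cong x≈ap y≈bp) (sym (distribʳ p a b)) }
    ; *-closed = λ { r (a , a∈I , x≈ap) →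
        r * a , *-closed I r a∈I , trans (*-congˡ x≈ap) (sym (*-assoc r a p)) }
    }

  -- On generators this is `a * (b * p) = b * (a * p)`. It lets one product ideal be a multiple of
  -- both `I` and `J`.
  InProduct-scaled-comm : (I J : Ideal D) → ∀ p → InProduct D I (scaledIdeal J p) ⊆ InProduct D J (scaledIdeal I p)
  InProduct-scaled-comm I J p = InProduct-⊆ I (scaledIdeal J p) (productIdeal J (scaledIdeal I p))
    λ { {a} a∈I (b , b∈J , w≈bp) → resp (productIdeal J (scaledIdeal I p))
          (sym (trans (*-congˡ w≈bp) (x∙yz≈y∙xz a b p)))
          (InProduct-∙ J (scaledIdeal I p) b∈J (a , a∈I , refl)) }

  module _ (nzd : NoZeroDivisors D) where

    -- The multiple is n(mp) = m(np).
    commonMultiple : (n m : NonzeroIdeal D) → ∀ p → ¬ (p ≈ 0#) →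
      ∃[ l ] Divides D n l × Divides D m l × (∀ {x} → member (ideal l) x → p ∣ x)
    commonMultiple n m p p≉0 =
      let (a , a∈I , a≉0) = nonzero n
          (b , b∈J , b≉0) = nonzero m
      in record
        { ideal   = productIdeal I (scaledIdeal J p)
        ; nonzero = a * (b * p) , InProduct-∙ I (scaledIdeal J p) a∈I (b , b∈J , refl) , nzd a≉0 (nzd b≉0 p≉0)
        }
      , (scaledIdeal J p , λ x → mk⇔ id id)
      , (scaledIdeal I p , λ x → mk⇔ (InProduct-scaled-comm I J p) (InProduct-scaled-comm J I p))
      , InProduct-⊆ I (scaledIdeal J p) (principalIdeal p)
          (λ { {a} _ (b , _ , w≈bp) → a * b , trans (*-assoc a b p) (*-congˡ (sym w≈bp)) })
      where
      I = ideal n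
      J = ideal m

    nonzeroProduct : ∀ {k} (v : Vector Carrier k) → (∀ i → ¬ (v i ≈ 0#)) → ¬ (1# ≈ 0#) → ¬ (product v ≈ 0#)
    nonzeroProduct {zero}  v v≉0 1≉0 = 1≉0
    nonzeroProduct {suc k} v v≉0 1≉0 = nzd (v≉0 zero) (nonzeroProduct (v ∘ suc) (v≉0 ∘ suc) 1≉0)

    module _ (em : ∀ {ℓ} → ExcludedMiddle ℓ) (1≉0 : ¬ (1# ≈ 0#)) (C : Coding _≈_) where
      private
        -- The value 1 for codes of no element keeps all the products below non-zero.
        decode′ : ∀ c → Dec (∃[ x ] ¬ (x ≈ 0#) × code C x ≡ c) → Carrier
        decode′ c (yes (x , _)) = x
        decode′ c (no _)        = 1#

        decode′-≉0 : ∀ c d → ¬ (decode′ c d ≈ 0#)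
        decode′-≉0 c (yes (_ , x≉0 , _)) = x≉0
        decode′-≉0 c (no _)              = 1≉0

        decode′-code : ∀ {x} → ¬ (x ≈ 0#) → ∀ d → decode′ (code C x) d ≈ x
        decode′-code x≉0 (yes (_ , _ , e)) = code-injective C e
        decode′-code x≉0 (no none)         = contradiction (_ , x≉0 , ≡.refl) none

        decode : Code → Carrier
        decode c = decode′ c em

        decodeProduct : List Code → Carrier
        decodeProduct []       = 1#
        decodeProduct (c ∷ cs) = decode c * decodeProduct cs

        decodeProduct-≉0 : ∀ cs → ¬ (decodeProduct cs ≈ 0#)
        decodeProduct-≉0 []       = 1≉0
        decodeProduct-≉0 (c ∷ cs) = nzd (decode′-≉0 c em) (decodeProduct-≉0 cs)

        ∈⇒∣decodeProduct : ∀ {c} {cs} → c ∈ cs → decode c ∣ decodeProduct cs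
        ∈⇒∣decodeProduct {cs = _ ∷ cs} (here ≡.refl) = decodeProduct cs , *-comm _ _
        ∈⇒∣decodeProduct (there c∈cs)  = ∣ʳ-trans (∈⇒∣decodeProduct c∈cs) (x∣ʳyx _ _)

        -- The analogue of the factorials: each term divides the next, and every non-zero element
        -- divides some term.
        modulus : ℕ → Carrier
        modulus zero    = 1#
        modulus (suc j) = decodeProduct (codesUpTo j) * modulus j

        modulus-≉0 : ∀ j → ¬ (modulus j ≈ 0#)
        modulus-≉0 zero    = 1≉0
        modulus-≉0 (suc j) = nzd (decodeProduct-≉0 (codesUpTo j)) (modulus-≉0 j)

        -- The code of `x` is listed among the codes up to its own height, and the product over that
        -- list enters the modulus one step later, whence the `suc`.
        ∣modulus : ∀ {x} → ¬ (x ≈ 0#) → x ∣ modulus (suc (height (code C x)))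
        ∣modulus {x} x≉0 = ∣ʳ-trans (∣ʳ-respˡ-≈ (decode′-code x≉0 em)
          (∈⇒∣decodeProduct (∈-codesUpTo (code C x) ℕₚ.≤-refl)))
          (modulus (height (code C x)) , *-comm _ _)

      -- A non-zero ideal contains some `a` other than 0, and therefore all multiples of any modulus
      -- that `a` divides.
      cofinalChain : CofinalChain D
      cofinalChain = record
        { chain      = λ j → principal (modulus j) (modulus-≉0 j)
        ; descending = λ j x → ∣ʳ-trans (x∣ʳyx _ _)
        ; cofinal    = λ n → let (a , a∈n , a≉0) = nonzero n in suc (height (code C a)) ,
            λ { x m∣x → let (q , qa≈x) = ∣ʳ-trans (∣modulus a≉0) m∣x
                        in resp (ideal n) qa≈x (*-closed (ideal n) q a∈n) }
        }

-- Measures of unions of cosets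

module ℝ-Reasoning = SetoidReasoning ≈ᴿ-setoid

funToFin-cong : ∀ {m n} {f g : Fin m → Fin n} → (∀ i → f i ≡ g i) → funToFin f ≡ funToFin g
funToFin-cong {zero}  f≡g = ≡.refl
funToFin-cong {suc m} f≡g = ≡.cong₂ combine (f≡g zero) (funToFin-cong (f≡g ∘ suc))

module _ {D : Ring₀} {m : ℕ} (μ : HaarMeasure D m) where

  -- The empty set is the disjoint union of two copies of itself, so its measure equals its own
  -- double.
  measure-∅ : ∀ W → (∀ x → ¬ set W x) → measure μ W ≈ᴿ 0ᴿ
  measure-∅ W none = x≈x+x⇒x≈0 (measure μ W) (additive μ W W W
    (λ { x (w , _) → none x w }) (λ x → mk⇔ inj₁ λ { (inj₁ w) → w ; (inj₂ w) → w }))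

  truncated-0 : ∀ {S n V v} → (∀ x → ¬ (set V x × Saturation D n S x)) → Truncated D μ S n V v → v ≈ᴿ 0ᴿ
  truncated-0 disjoint (empty _ v≈0) = v≈0
  truncated-0 {v = v} disjoint (nonempty _ N M _ _ W W⇔ v≈) = begin
    v
      ≈⟨ v≈ ⟩
    fromℚ q *ᴿ measure μ W
      ≈⟨ scale-cong q {measure μ W} {0ᴿ} (measure-∅ W λ x w → disjoint x (Equivalence.to (W⇔ x) w)) ⟩
    fromℚ q *ᴿ 0ᴿ
      ≈⟨ scale-0 q ⟩
    0ᴿ  ∎
    where
    open ℝ-Reasoning
    q : ℚ
    q = (+ (N ℕ.^ m)) ℚ./ M

  -- A truncated value of a nonempty set can only come from the second constructor, which records
  -- the cardinality of `D/n`.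
  truncated⇒finite : ∀ {S n V v} → ∃ S → Truncated D μ S n V v → ∃[ N ] HasCardinality (quotient D n) U N
  truncated⇒finite (x , Sx) (empty none _)                = contradiction Sx (none x)
  truncated⇒finite _        (nonempty _ N _ finite _ _ _ _) = N , finite

module _ (em : ∀ {ℓ} → ExcludedMiddle ℓ) {D : Ring₀} (finite : FiniteQuotients D) (chain : CofinalChain D)
         {m : ℕ} (μ : HaarMeasure D m) (n : NonzeroIdeal D) where
  private
    module D = CommutativeRing D
    module Q = Setoid (quotient D n)
    module Qᵐ = Setoid (vectorSetoid (quotient D n) m)

  Cosets : ∀ {L} → (Fin L → Vector D.Carrier m) → Subset D m
  Cosets r x = Lift (lsuc 0ℓ) (∃[ l ] r l Qᵐ.≈ λ i → at (x i) n)

  cosets : ∀ {L} → (Fin L → Vector D.Carrier m) → CompactOpen D m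
  cosets r = saturated⇒compactOpen D em finite chain (Cosets r) n λ x y x≡y (lift (l , p)) →
    lift (l , λ i → Q.trans {_} {at (x i) n} (p i) (x≡y i))

  coset : Vector D.Carrier m → CompactOpen D m
  coset r = cosets {1} λ _ → r

  0-coset : CompactOpen D m
  0-coset = coset λ _ → D.0#

  -- Translation by `r` carries the coset of 0 to that of `r`; `shift` matches the differences that
  -- express the two congruences.
  measure-coset : ∀ r → measure μ (coset r) ≈ᴿ measure μ 0-coset
  measure-coset r = ≈ᴿ-sym {measure μ 0-coset} {measure μ (coset r)}
    (invariant μ (λ i → embed D (r i)) 0-coset (coset r) λ x → mk⇔
      (λ { (lift (l , p)) → lift (l , λ i → resp (ideal n) (shift (r i) (at (x i) n)) (p i)) })
      (λ { (lift (l , p)) → lift (l , λ i → resp (ideal n) (D.sym (shift (r i) (at (x i) n))) (p i)) }))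
    where
    open RingProperties D.ring using (-‿+-comm)
    open SetoidReasoning D.setoid
    shift : ∀ a b → D.0# D.- b D.≈ a D.- (a D.+ b)
    shift a b = begin
      D.0# D.- b               ≈⟨ D.+-congʳ (D.-‿inverseʳ a) ⟨
      (a D.- a) D.- b          ≈⟨ D.+-assoc a (D.- a) (D.- b) ⟩
      a D.+ (D.- a D.- b)      ≈⟨ D.+-congˡ (-‿+-comm a b) ⟩
      a D.- (a D.+ b)          ∎

  -- Induction splits off one coset, and inequivalence of the representatives makes it disjoint from
  -- the others. The set `W` is arbitrary up to having the same points, because a truncated measure
  -- comes with a `W` of its own.
  measure-cosets : ∀ {L} (r : Fin L → Vector D.Carrier m) → (∀ {k l} → r k Qᵐ.≈ r l → k ≡ l) →
    ∀ W → (∀ x → set W x ⇔ Cosets r x) → measure μ W ≈ᴿ fromℚ (natural L) *ᴿ measure μ 0-coset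
  measure-cosets {zero} r r-inj W W⇔ = begin
    measure μ W      ≈⟨ measure-∅ μ W (λ x w → no-coset x (Equivalence.to (W⇔ x) w)) ⟩
    0ᴿ               ≈⟨ ≡⇒≈ᴿ {fromℚ 0ℚ *ᴿ c} {0ᴿ} (λ k → ℚₚ.*-zeroˡ (seq c k)) ⟨
    fromℚ 0ℚ *ᴿ c    ∎
    where
    open ℝ-Reasoning
    c = measure μ 0-coset
    no-coset : ∀ x → ¬ Cosets r x
    no-coset x (lift (() , _))
  measure-cosets {suc L} r r-inj W W⇔ = begin
    measure μ W
      ≈⟨ additive μ (coset (r zero)) (cosets (r ∘ suc)) W disjoint
           (λ x → mk⇔ (split x ∘ Equivalence.to (W⇔ x)) (Equivalence.from (W⇔ x) ∘ join x)) ⟩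
    measure μ (coset (r zero)) +ᴿ measure μ (cosets (r ∘ suc))
      ≈⟨ +ᴿ-cong {measure μ (coset (r zero))} {c} {measure μ (cosets (r ∘ suc))} {fromℚ (natural L) *ᴿ c}
           (measure-coset (r zero))
           (measure-cosets (r ∘ suc) (Finₚ.suc-injective ∘ r-inj) (cosets (r ∘ suc)) λ x → mk⇔ id id) ⟩
    c +ᴿ fromℚ (natural L) *ᴿ c
      ≈⟨ ≡⇒≈ᴿ {c +ᴿ fromℚ (natural L) *ᴿ c} {fromℚ (natural (suc L)) *ᴿ c} (λ k → one-more (seq c k)) ⟩
    fromℚ (natural (suc L)) *ᴿ c  ∎
    where
    open ℝ-Reasoning
    c = measure μ 0-coset
    one-more : ∀ a → a ℚ.+ natural L ℚ.* a ≡ natural (suc L) ℚ.* a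
    one-more a = ≡.trans (≡.cong (ℚ._+ natural L ℚ.* a) (≡.sym (ℚₚ.*-identityˡ a)))
      (≡.trans (≡.sym (ℚₚ.*-distribʳ-+ a 1ℚ (natural L))) (≡.cong (ℚ._* a) (≡.sym (natural-suc L))))
    disjoint : ∀ x → ¬ (set (coset (r zero)) x × Cosets (r ∘ suc) x)
    disjoint x (lift (_ , p) , lift (l , q))
      with () ← r-inj {zero} {suc l} (Qᵐ.trans {_} {λ i → at (x i) n} p (Qᵐ.sym {r (suc l)} q))
    split : ∀ x → Cosets r x → Cosets {1} (λ _ → r zero) x ⊎ Cosets (r ∘ suc) x
    split x (lift (zero  , p)) = inj₁ (lift (zero , p))
    split x (lift (suc l , p)) = inj₂ (lift (l , p))
    join : ∀ x → Cosets {1} (λ _ → r zero) x ⊎ Cosets (r ∘ suc) x → Cosets r x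
    join x (inj₁ (lift (_ , p))) = lift (zero , p)
    join x (inj₂ (lift (l , p))) = lift (suc l , p)

  -- All `N ^ m` cosets together fill the space, which has measure 1. This determines the measure of
  -- one coset without dividing real numbers.
  measure-total : ∀ {N} → HasCardinality (quotient D n) U N →
                  fromℚ (natural (N ℕ.^ m)) *ᴿ measure μ 0-coset ≈ᴿ 1ᴿ
  measure-total {N} card = begin
    fromℚ (natural (N ℕ.^ m)) *ᴿ measure μ 0-coset  ≈⟨ measure-cosets r r-inj (cosets r) (λ x → mk⇔ id id) ⟨
    measure μ (cosets r)                            ≈⟨ normalized μ (cosets r) everything ⟩
    1ᴿ                                              ∎
    where
    open ℝ-Reasoning
    open HasCardinality card
    r : Fin (N ℕ.^ m) → Vector D.Carrier m
    r l i = e (finToFun l i)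
    r-inj : ∀ {k l} → r k Qᵐ.≈ r l → k ≡ l
    r-inj {k} {l} p = ≡.trans (≡.sym (Finₚ.funToFin-finToFin {m} {N} k))
      (≡.trans (funToFin-cong λ i → injective (p i)) (Finₚ.funToFin-finToFin {m} {N} l))
    everything : ∀ x → Cosets r x
    everything x = lift (funToFin f , λ i → ≡.subst (λ j → Congruent D n (e j) (at (x i) n))
        (≡.sym (Finₚ.finToFun-funToFin f i)) (proj₂ (surjective _)))
      where
      f : Fin m → Fin N
      f i = proj₁ (surjective {at (x i) n} _)

  -- Since `V` contains the saturation of `S`, the set `W` is that saturation, a union of `M`
  -- cosets. The factor `N ^ m / M` turns their measure into that of `N ^ m` cosets, which is 1.
  truncated-1 : ∀ {S V v} → ∃ S → (∀ x → Saturation D n S x → set V x) → Truncated D μ S n V v → v ≈ᴿ 1ᴿ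
  truncated-1 (x , Sx) _ (empty none _) = contradiction Sx (none x)
  truncated-1 {S} {V} {v} _ sat⊆V (nonempty _ N M cardN cardM W W⇔ v≈) = begin
    v
      ≈⟨ v≈ ⟩
    fromℚ q *ᴿ measure μ W
      ≈⟨ scale-cong q {measure μ W} {fromℚ (natural M) *ᴿ c} (measure-cosets e injective W W⇔cosets) ⟩
    fromℚ q *ᴿ (fromℚ (natural M) *ᴿ c)
      ≈⟨ ≡⇒≈ᴿ {fromℚ q *ᴿ (fromℚ (natural M) *ᴿ c)} {fromℚ (natural (N ℕ.^ m)) *ᴿ c} (λ k →
           ≡.trans (≡.sym (ℚₚ.*-assoc q (natural M) (seq c k)))
             (≡.cong (ℚ._* seq c k) (/-*-natural (N ℕ.^ m) M))) ⟩
    fromℚ (natural (N ℕ.^ m)) *ᴿ c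
      ≈⟨ measure-total cardN ⟩
    1ᴿ  ∎
    where
    open ℝ-Reasoning
    open HasCardinality cardM
    q = (+ (N ℕ.^ m)) ℚ./ M
    c = measure μ 0-coset
    W⇔cosets : ∀ x → set W x ⇔ Cosets e x
    W⇔cosets x = mk⇔
      (λ w → lift (surjective (proj₂ (Equivalence.to (W⇔ x) w))))
      (λ { (lift (l , p)) →
        let (y , Sy , y≡) = e-in l
            sat = y , Sy , λ i → Q.trans {_} {e l i} (y≡ i) (p i)
        in Equivalence.from (W⇔ x) (sat⊆V x sat , sat) })

-- Values of polynomials

module _ {c ℓ} {D : Ring₀} {R : CommutativeRing c ℓ} {φ} (hom : IsHom D R φ) where
  private
    module D = CommutativeRing D
    module φ = IsHom D R hom
  open CommutativeRing R hiding (zero)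
  open RingDefinitions D using (_+ₚ_; _*ₚ_; productₚ)
  open RingDefinitions R using (_∣_)
  open RawMagmaDefinitions *-rawMagma using (_,_)
  open Divisibility semiring using (∣ʳ-trans)
  open CommutativeSemigroupProperties +-commutativeSemigroup using (interchange)
  open CommutativeSemigroupProperties *-commutativeSemigroup using (x∙yz≈y∙xz)
  open SetoidReasoning setoid

  module _ (x : Carrier) where

    -- With `φ` the embedding of `D` into its completion this is `evalD̂`.
    evalVia : List D.Carrier → Carrier
    evalVia p = RingDefinitions.eval R (map φ p) x

    eval-+ₚ : ∀ p q → evalVia (p +ₚ q) ≈ evalVia p + evalVia q
    eval-+ₚ []      q       = sym (+-identityˡ (evalVia q))
    eval-+ₚ (a ∷ p) []      = sym (+-identityʳ (evalVia (a ∷ p)))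
    eval-+ₚ (a ∷ p) (b ∷ q) = begin
      φ (a D.+ b) + x * evalVia (p +ₚ q)               ≈⟨ +-cong (φ.+-homo a b) (*-congˡ (eval-+ₚ p q)) ⟩
      (φ a + φ b) + x * (evalVia p + evalVia q)        ≈⟨ +-congˡ (distribˡ x (evalVia p) (evalVia q)) ⟩
      (φ a + φ b) + (x * evalVia p + x * evalVia q)    ≈⟨ interchange (φ a) (φ b) (x * evalVia p) (x * evalVia q) ⟩
      (φ a + x * evalVia p) + (φ b + x * evalVia q)    ∎

    eval-scale : ∀ a q → evalVia (map (a D.*_) q) ≈ φ a * evalVia q
    eval-scale a []      = sym (zeroʳ (φ a))
    eval-scale a (b ∷ q) = begin
      φ (a D.* b) + x * evalVia (map (a D.*_) q)       ≈⟨ +-cong (φ.*-homo a b) (*-congˡ (eval-scale a q)) ⟩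
      φ a * φ b + x * (φ a * evalVia q)                ≈⟨ +-congˡ (x∙yz≈y∙xz x (φ a) (evalVia q)) ⟩
      φ a * φ b + φ a * (x * evalVia q)                ≈⟨ distribˡ (φ a) (φ b) (x * evalVia q) ⟨
      φ a * (φ b + x * evalVia q)                      ∎

    eval-*ₚ : ∀ p q → evalVia (p *ₚ q) ≈ evalVia p * evalVia q
    eval-*ₚ []      q = sym (zeroˡ (evalVia q))
    eval-*ₚ (a ∷ p) q = begin
      evalVia (map (a D.*_) q +ₚ (D.0# ∷ p *ₚ q))
        ≈⟨ eval-+ₚ (map (a D.*_) q) (D.0# ∷ p *ₚ q) ⟩
      evalVia (map (a D.*_) q) + (φ D.0# + x * evalVia (p *ₚ q))
        ≈⟨ +-cong (eval-scale a q) (trans (+-congʳ φ.0#-homo) (+-identityˡ _)) ⟩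
      φ a * evalVia q + x * evalVia (p *ₚ q)
        ≈⟨ +-congˡ (trans (*-congˡ (eval-*ₚ p q)) (sym (*-assoc x (evalVia p) (evalVia q)))) ⟩
      φ a * evalVia q + (x * evalVia p) * evalVia q
        ≈⟨ distribʳ (evalVia q) (φ a) (x * evalVia p) ⟨
      (φ a + x * evalVia p) * evalVia q                ∎

    -- Evaluation is multiplicative. Divisors of units are units, so a unit value of the product of
    -- the polynomials yields a point where every factor has a unit value.
    eval-∣-productₚ : ∀ {k} (f : Fin k → List D.Carrier) i → evalVia (f i) ∣ evalVia (productₚ f)
    eval-∣-productₚ f zero    = evalVia (productₚ (f ∘ suc)) ,
      trans (*-comm _ _) (sym (eval-*ₚ (f zero) (productₚ (f ∘ suc))))
    eval-∣-productₚ f (suc i) = ∣ʳ-trans (eval-∣-productₚ (f ∘ suc) i)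
      (evalVia (f zero) , sym (eval-*ₚ (f zero) (productₚ (f ∘ suc))))

-- Prime elements and units

module _ (D : Ring₀) where
  private
    module D = CommutativeRing D
    module Q (n : NonzeroIdeal D) = Setoid (quotient D n)
  open D hiding (zero)
  open RingDefinitions D using (product; _∣_; IsPrimeElement)
  open RawMagmaDefinitions *-rawMagma using (_,_)
  open Divisibility semiring using (∣ʳ-trans; ∣ʳ-refl; ∣ʳ-respˡ-≈; x∣ʳyx)
  open RingProperties ring using ([y-z]x≈yx-zx)

  embed-isHom : IsHom D (completion D) (embed D)
  embed-isHom = record
    { isSemiringHomomorphism = record
      { isNearSemiringHomomorphism = record
        { +-isMonoidHomomorphism = record
          { isMagmaHomomorphism = record
            { isRelHomomorphism = record { cong = λ x≈y n → ≈⇒congruent n x≈y }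
            ; homo = λ x y n → Q.refl n
            }
          ; ε-homo = λ n → Q.refl n
          }
        ; *-homo = λ x y n → Q.refl n
        }
      ; 1#-homo = λ n → Q.refl n
      }
    ; -‿homo = λ x n → Q.refl n
    }
    where
    ≈⇒congruent : ∀ n {x y} → x ≈ y → Congruent D n x y
    ≈⇒congruent n {x} {y} x≈y = resp (ideal n) (sym (trans (+-congʳ x≈y) (-‿inverseʳ y))) (0-closed (ideal n))

  congruent-*ʳ : ∀ n b {x y} → Congruent D n x y → Congruent D n (x * b) (y * b)
  congruent-*ʳ n b {x} {y} x≡y =
    resp (ideal n) (trans (*-comm b (x - y)) ([y-z]x≈yx-zx b x y)) (*-closed (ideal n) b x≡y)

  congruent-member : ∀ n {x y} → Congruent D n x y → member (ideal n) y → member (ideal n) x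
  congruent-member n {x} {y} x≡y y∈n = resp (ideal n) (begin
    (x - y) + y      ≈⟨ +-assoc x (- y) y ⟩
    x + (- y + y)    ≈⟨ +-congˡ (-‿inverseˡ y) ⟩
    x + 0#           ≈⟨ +-identityʳ x ⟩
    x                ∎)
    (+-closed (ideal n) x≡y y∈n)
    where open SetoidReasoning setoid

  ∣product : ∀ {k} (v : Vector Carrier k) i → v i ∣ product v
  ∣product v zero    = product (v ∘ suc) , *-comm _ _
  ∣product v (suc i) = ∣ʳ-trans (∣product (v ∘ suc) i) (x∣ʳyx _ _)

  -- Irreducibility applied to `0 = 0 * 0` would make 0 a unit, and an irreducible element is not a
  -- unit.
  prime⇒≉0 : ∀ {p} → IsPrimeElement p → ¬ (p ≈ 0#)
  prime⇒≉0 {p} (irreducible , _) p≈0 = p∤1 (∣ʳ-respˡ-≈ (sym p≈0) 0∣1)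
    where
    open RawSemiringDefinitions.Irreducible irreducible
    0∣1 : 0# ∣ 1#
    0∣1 with split-∣1 (trans p≈0 (sym (zeroˡ 0#)))
    ... | inj₁ d = d
    ... | inj₂ d = d

  -- Any non-zero a ∈ n gives the multiple n₀(n₀a) of n₀ inside n.
  finiteQuotients : NoZeroDivisors D → ∀ n₀ →
    (∀ n → Divides D n₀ n → ∃[ N ] HasCardinality (quotient D n) U N) → FiniteQuotients D
  finiteQuotients nzd n₀ finite n =
    let (a , a∈n , a≉0) = nonzero n
        (l , n₀∣l , _ , l⊆aD) = commonMultiple D nzd n₀ n₀ a a≉0
        (N , card) = finite l n₀∣l
        open HasCardinality card
    in N , e , λ x →
      let (i , eᵢ≡x) = surjective {x} _
          (q , qa≈) = l⊆aD eᵢ≡x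
      in i , resp (ideal n) qa≈ (*-closed (ideal n) q a∈n)

  -- Its compactness requires no finiteness of the quotients, so it can serve as the test set from
  -- which that finiteness is read off.
  ∅ : ∀ {m} → CompactOpen D m
  ∅ = record
    { set       = λ _ → Lift _ ⊥
    ; isOpen    = λ { _ (lift ()) }
    ; isCompact = λ _ _ _ → [] , λ { _ (lift ()) }
    }

  module _ (p : Carrier) (p≉0 : ¬ (p ≈ 0#)) where
    private
      n₀ = principal D p p≉0

    UnitModulo : ∀ {k} → Subset D (suc k)
    UnitModulo y = Lift _ (∃[ b ] Congruent D n₀ (at (y zero) n₀ * b) 1#)

    unitModulo-saturated : ∀ {k} → IsSaturated D n₀ (UnitModulo {k})
    unitModulo-saturated x y x≡y (lift (b , xb≡1)) =
      lift (b , Q.trans n₀ {_} {at (x zero) n₀ * b}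
        (congruent-*ʳ n₀ b {at (y zero) n₀} (Q.sym n₀ {at (x zero) n₀} (x≡y zero))) xb≡1)

    unit⇒unitModulo : ∀ {k} (y : Power D (suc k)) →
                      RingDefinitions.IsUnit (completion D) (y zero) → UnitModulo y
    unit⇒unitModulo y (RawMagmaDefinitions._,_ q qy≋1) =
      lift (at q n₀ , resp (ideal n₀) (+-congʳ (*-comm (at q n₀) (at (y zero) n₀))) (qy≋1 n₀))

    -- As `q` divides `p`, both congruences hold modulo `q`. There the first coordinate is 0, while
    -- its product with `b` is 1, so `q` would divide 1.
    primeDivisor⇒¬unitModulo : ∀ {k q} (y : Power D (suc k)) → IsPrimeElement q → q ∣ p →
      Congruent D n₀ (at (y zero) n₀) q → ¬ UnitModulo y
    primeDivisor⇒¬unitModulo {q = q} y q-prime@(_ , q-ideal) q∣p y≡q (lift (b , yb≡1)) =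
      RingDefinitions.IsPrimeIdeal.proper q-ideal
        (congruent-member nq {1#} {at (y zero) n₀ * b} (Q.sym nq {at (y zero) n₀ * b} (∣ʳ-trans q∣p yb≡1))
          (resp (ideal nq) (*-comm b (at (y zero) n₀)) (*-closed (ideal nq) b
            (congruent-member nq {at (y zero) n₀} (∣ʳ-trans q∣p y≡q) ∣ʳ-refl))))
      where
      nq = principal D q (prime⇒≉0 q-prime)

-- Infinitely many prime values from the equality of procounting measures

proposition3p26 : (∀ {ℓ} → ExcludedMiddle ℓ) →
    (F : Ring₀) → IsGlobalField F → ¬ CharacteristicTwo F →
    (𝒮 : List (AbsoluteValue F)) → 𝒮 ≢ [] → ContainsArchimedean F 𝒮 →
    (D : Ring₀) (ι : CommutativeRing.Carrier D → CommutativeRing.Carrier F) →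
    IsRingOfSIntegers F 𝒮 D ι →
    (μ : ∀ m → HaarMeasure D m) →
    ProfiniteBatemanHorn F D ι μ →
    ExtendedSchinzelH F D ι
proposition3p26 em F global _ 𝒮 _ _ D ι S-integers μ bateman-horn (suc k) 1≤d f admissible (L , card)
  with bateman-horn (suc k) 1≤d f admissible
... | _ , ν , S-limit , T-limit =
  let (n₁ , S-near) = S-limit V ¼ ¼>0
      (n₂ , T-near) = T-limit V ¼ ¼>0
      -- A common multiple of `n₁` and `n₂` puts both truncated values close to the limit; being
      -- inside `pD` as well, it makes `V` a union of fibres modulo `n`.
      (n , n₁∣n , n₂∣n , n⊆n₀) = commonMultiple D nzd n₁ n₂ p p≉0
      (v , S-value , v-near) = S-near n n₁∣n
      (w , T-value , w-near) = T-near n n₂∣n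
  in no-common-limit {v} {w} {ν V}
       (truncated-0 (μ (suc k)) (S-disjoint n (λ _ → n⊆n₀)) S-value)
       (truncated-1 em finite chain (μ (suc k)) n T-nonempty (T-inside n (λ _ → n⊆n₀)) T-value)
       v-near w-near
  where
  module D = CommutativeRing D
  module F = CommutativeRing F
  module D̂ = CommutativeRing (completion D)
  open HasCardinality card
  open IsRingOfSIntegers S-integers using (embedding)
  module ι = IsEmbedding D F embedding
  isField = IsGlobalField.isField global

  nzd : NoZeroDivisors D
  nzd = subring⇒noZeroDivisors {D} {F} {ι} embedding (field⇒noZeroDivisors {F} isField)

  1≉0 : ¬ (D.1# D.≈ D.0#)
  1≉0 1≈0 = RingDefinitions.IsField.1≉0 isField
    (F.trans (F.sym ι.1#-homo) (F.trans (ι.⟦⟧-cong 1≈0) ι.0#-homo))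

  chain : CofinalChain D
  chain = cofinalChain D nzd em 1≉0 (embedding-coding {D} {F} {ι} embedding (globalField-coding global))

  ¼>0 : 0ℚ ℚ.< ¼
  ¼>0 = ℚₚ.positive⁻¹ ¼

  T-nonempty : ∃ (UnitValues F D ι f)
  T-nonempty = let (a , unit) = IsAdmissible.unitValue admissible in
    (λ i → evalD̂ F D ι (f i) a) , (a , λ i → D̂.refl {evalD̂ F D ι (f i) a}) ,
    λ i → Divisibility.∣ʳ-trans D̂.semiring (eval-∣-productₚ {R = completion D} (embed-isHom D) a f i) unit

  finite : FiniteQuotients D
  finite = let (n₀ , T-near) = T-limit (∅ D) ¼ ¼>0 in
    finiteQuotients D nzd n₀ λ n n₀∣n →
      truncated⇒finite (μ (suc k)) T-nonempty (proj₁ (proj₂ (T-near n n₀∣n)))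

  p : D.Carrier
  -- For an empty enumeration this is 1, and then `V` is the whole space.
  p = RingDefinitions.product D (λ l → e l zero)

  p≉0 : ¬ (p D.≈ D.0#)
  p≉0 = nonzeroProduct D nzd (λ l → e l zero) (λ l → prime⇒≉0 D (proj₂ (e-in l) zero)) 1≉0

  n₀ : NonzeroIdeal D
  n₀ = principal D p p≉0

  V : CompactOpen D (suc k)
  V = saturated⇒compactOpen D em finite chain (UnitModulo D p p≉0) n₀ (unitModulo-saturated D p p≉0)

  -- A point of the saturation is congruent modulo `n`, hence modulo `p`, to some enumerated `e l`,
  -- whose first coordinate is a prime element dividing `p`.
  S-disjoint : ∀ n → _≼_ D n n₀ → ∀ x → ¬ (set V x × Saturation D n (PrimeValues^ F D ι f) x)
  S-disjoint n n≼n₀ x (x∈V , s , (z , (z∈S , s≋z)) , s≡x) =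
    primeDivisor⇒¬unitModulo D p p≉0 x (proj₂ (e-in l) zero) (∣product D (λ l → e l zero) l)
      (coarsen D n≼n₀ (x zero) (embed D (e l zero)) (begin
        at (x zero) n  ≈⟨ s≡x zero ⟨
        at (s zero) n  ≈⟨ s≋z zero n ⟩
        z zero         ≈⟨ IsHom.⟦⟧-cong D (completion D) (embed-isHom D) (eₗ≈z zero) n ⟨
        e l zero       ∎))
      x∈V
    where
    open SetoidReasoning (quotient D n)
    l = proj₁ (surjective z∈S)
    eₗ≈z = proj₂ (surjective z∈S)

  -- Units of the completion are units modulo `p`, and this property passes to every point congruent
  -- modulo `n`.
  T-inside : ∀ n → _≼_ D n n₀ → ∀ x → Saturation D n (UnitValues F D ι f) x → set V x
  T-inside n n≼n₀ x (y , (_ , y-unit) , y≡x) = unitModulo-saturated D p p≉0 y x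
    (λ i → coarsen D n≼n₀ (y i) (x i) (y≡x i))
    (unit⇒unitModulo D p p≉0 y (y-unit zero))
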